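{- Let $n$ be a squarefree positive integer which is not a prime and assume that every prime divisor of $n$ is at least $7$. Then a sequence in $\mathbb{Z}_n$ is a $C$-extremal sequence for $S(n)$ if and only if it is a $C$-extremal sequence for $U(n)$.
   Context: $\mathbb{Z}_n$ denotes the ring $\mathbb{Z}/n\mathbb{Z}$ and $U(n)$ its group of units. For odd $n$ and $x\in U(n)$, $\left(\frac{x}{n}\right)$ denotes the Jacobi symbol, and $S(n)=\{x\in U(n):\left(\frac{x}{n}\right)=1\}$. For $A\subseteq\mathbb{Z}_n$, a (nonempty, finite) sequence $(y_1,\ldots,y_k)$ in $\mathbb{Z}_n$ is an $A$-weighted zero-sum sequence if there exist $a_1,\ldots,a_k\in A$ with $a_1y_1+\cdots+a_ky_k=0$. The constant $C_A(n)$ is the least positive integer $k$ such that every sequence of length $k$ in $\mathbb{Z}_n$ has a (nonempty) subsequence of consecutive terms that is an $A$-weighted zero-sum sequence. If $0\notin A$, a $C$-extremal sequence for $A$ is a sequence in $\mathbb{Z}_n$ of length $C_A(n)-1$ which has no $A$-weighted zero-sum subsequence of consecutive terms. -}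

module Defs where

open import Algebra.Definitions using (Invertible)
open import Data.Bool.Base using (if_then_else_)
open import Data.Fin.Base using (Fin; toℕ)
open import Data.Fin.Properties using (any?)
open import Data.Integer.Base as ℤ using (ℤ; +_; 0ℤ; 1ℤ; -1ℤ)
open import Data.Integer.Divisibility.Signed as ℤ∣ using ()
open import Data.List.Base using (List; []; foldr; map; zipWith; length)
open import Data.List.Relation.Binary.Infix.Heterogeneous using (Infix)
open import Data.List.Relation.Unary.All using (All)
open import Data.Nat.Base using (ℕ; _+_; _*_; _∸_; _≤_; NonZero)
open import Data.Nat.Divisibility using (_∣_)
open import Data.Nat.DivMod using (_mod_)
open import Data.Nat.Primality.Factorisation using (factors; factorise)
open import Data.Product.Base using (∃-syntax; _×_)
open import Level using (0ℓ)
open import Relation.Binary.PropositionalEquality.Core using (_≡_; _≢_)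
open import Relation.Nullary.Decidable using (Dec; does)
open import Relation.Nullary.Negation using (¬_)
open import Relation.Unary using (Pred)

Squarefree : ℕ → Set
Squarefree n = ∀ d → d * d ∣ n → d ≡ 1

-- For n ≥ 1, the ring ℤ/nℤ is represented by the least residues 0, …, n - 1.
ℤ/_ : ℕ → Set
ℤ/ n = Fin n

module _ {n : ℕ} .{{_ : NonZero n}} where

  infixl 6 _+ₙ_
  infixl 7 _*ₙ_

  0ₙ 1ₙ : ℤ/ n
  0ₙ = 0 mod n
  1ₙ = 1 mod n

  _+ₙ_ _*ₙ_ : ℤ/ n → ℤ/ n → ℤ/ n
  x +ₙ y = (toℕ x + toℕ y) mod n
  x *ₙ y = (toℕ x * toℕ y) mod n

  sumₙ : List (ℤ/ n) → ℤ/ n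
  sumₙ = foldr _+ₙ_ 0ₙ

-- It is enough to let the square root y run over the residues 0, …, p - 1.
QuadraticResidue : ℤ → ℕ → Set
QuadraticResidue a p = ∃[ y ] + p ℤ∣.∣ (+ toℕ {p} y) ℤ.* (+ toℕ y) ℤ.- a

quadraticResidue? : ∀ a p → Dec (QuadraticResidue a p)
quadraticResidue? a p = any? λ y → + p ℤ∣.∣? (+ toℕ y) ℤ.* (+ toℕ y) ℤ.- a

-- Meaningful only for an odd prime p.
legendre : ℤ → ℕ → ℤ
legendre a p =
  if does (+ p ℤ∣.∣? a) then 0ℤ
  else if does (quadraticResidue? a p) then 1ℤ
  else -1ℤ

-- The prime factors are listed with multiplicity. Meaningful only for odd n.
jacobi : ℤ → (n : ℕ) → .{{NonZero n}} → ℤ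
jacobi a n = foldr ℤ._*_ 1ℤ (map (legendre a) (factors (factorise n)))

U : (n : ℕ) → .{{NonZero n}} → Pred (ℤ/ n) 0ℓ
U n x = Invertible _≡_ 1ₙ _*ₙ_ x

S : (n : ℕ) → .{{NonZero n}} → Pred (ℤ/ n) 0ℓ
S n x = U n x × jacobi (+ toℕ x) n ≡ 1ℤ

module _ {n : ℕ} .{{_ : NonZero n}} (A : Pred (ℤ/ n) 0ℓ) where

  WeightedZeroSum : List (ℤ/ n) → Set
  WeightedZeroSum ys =
    ys ≢ [] ×
    (∃[ as ] length as ≡ length ys × All A as × sumₙ (zipWith _*ₙ_ as ys) ≡ 0ₙ)

  -- An infix with respect to _≡_ is a subsequence of consecutive terms.
  HasConsecutiveZeroSum : List (ℤ/ n) → Set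
  HasConsecutiveZeroSum xs = ∃[ ys ] Infix _≡_ ys xs × WeightedZeroSum ys

  Forces : ℕ → Set
  Forces k = ∀ xs → length xs ≡ k → HasConsecutiveZeroSum xs

  -- The relation "C_A(n) = k".
  IsC : ℕ → Set
  IsC k = 1 ≤ k × Forces k × (∀ j → 1 ≤ j → Forces j → k ≤ j)

  -- Imposed for every A: if 0 ∈ A then C_A(n) = 1, and exactly the empty
  -- sequence qualifies.
  CExtremal : List (ℤ/ n) → Set
  CExtremal xs = ∃[ k ] IsC k × length xs ≡ k ∸ 1 × ¬ HasConsecutiveZeroSum xs

{-# OPTIONS --safe #-}
module Submission where

-- Let r be the number of prime divisors of n; the case r = 0 is trivial, so let r ≥ 2.
-- A sequence is U(n)-weighted zero-sum iff no prime p ∣ n leaves exactly one term nonzero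
-- modulo p. For p ≥ 7, a ternary form A x² + B y² + C z² represents every residue with
-- x, y, z ≠ 0, so a prime with at least three nonzero terms, or with none, admits a zero-sum
-- whose coefficients have arbitrary prescribed quadratic characters, which can compensate the
-- characters at the other primes. If every prime has exactly two nonzero terms, then one prime
-- fixes the character of every coefficient but the j-th, and a prime dividing the j-th term
-- fixes that one; such a j exists unless all primes have the same support. Hence a
-- U(n)-weighted zero-sum sequence of at least three nonzero terms, or having no nonzero term
-- modulo some prime, is S(n)-weighted zero-sum. This gives C_S(n) = C_U(n) = 2^r. Finally, if
-- a U(n)-weighted zero-sum block is not S(n)-weighted zero-sum, then every prime has at least
-- two nonzero terms in it, hence in the whole sequence, which then is S(n)-weighted zero-sum.

open import Defs
open import Data.Bool.Base using (if_then_else_)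
open import Data.Empty using (⊥; ⊥-elim)
open import Data.Fin.Base as Fin using (Fin; zero; suc; toℕ; fromℕ<; splitAt; join)
open import Data.Fin.Properties using (any?; pigeonhole; toℕ-fromℕ<; toℕ-injective; toℕ<n; join-splitAt)
import Data.Fin.Properties as Fin
open import Data.Integer.Base using (ℤ; +_; 0ℤ; 1ℤ; -1ℤ; _+_; _*_; _-_; -_; _/ℕ_; _%ℕ_)
open import Data.Integer.Divisibility.Signed
  using (divides; ∣⇒∣ᵤ; ∣ᵤ⇒∣; ∣-trans; ∣m∣n⇒∣m+n; ∣n⇒∣m*n; ∣m⇒∣m*n; _∣?_)
  renaming (_∣_ to _∣ᶻ_)
open import Data.Integer.DivMod using (n%ℕd<d; a≡a%ℕn+[a/ℕn]*n)
import Data.Integer.Properties as ℤ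
open import Data.Integer.Tactic.RingSolver using (solve-∀)
open import Data.List.Base using (List; []; _∷_; _++_; foldr; map; length; lookup; tabulate; zipWith; take; drop)
open import Data.List.Membership.Propositional using (_∈_; find; lose)
open import Data.List.Membership.Propositional.Properties using (∈-lookup; ∈-∃++)
import Data.List.Properties as List
open import Data.List.Relation.Binary.Infix.Heterogeneous using (Infix; here; there; _++ⁱ_; _ⁱ++_)
open import Data.List.Relation.Binary.Infix.Heterogeneous.Properties using (fromPointwise)
import Data.List.Relation.Binary.Pointwise as Pointwise
open import Data.List.Relation.Binary.Prefix.Heterogeneous using (Prefix; []; _∷_)
open import Data.List.Relation.Unary.All as All using (All; []; _∷_)
import Data.List.Relation.Unary.All.Properties as All
open import Data.List.Relation.Unary.AllPairs.Core using ([]; _∷_)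
open import Data.List.Relation.Unary.Any as Any using (Any; here; there)
open import Data.List.Relation.Unary.Unique.Propositional using (Unique)
open import Data.Nat.Base as ℕ using (ℕ; zero; suc; _≤_; NonZero; z≤n; s≤s)
open import Data.Nat.Coprimality using (prime⇒coprime; coprime-Bézout)
open import Data.Nat.Divisibility using (_∣_)
import Data.Nat.Divisibility as ℕ∣
open import Data.Nat.DivMod using (m≡m%n+[m/n]*n; m%n<n; m/n*n≤m)
open import Data.Nat.GCD using (module Bézout)
open import Data.Nat.ListAction using (product)
open import Data.Nat.ListAction.Properties using (∈⇒∣product)
open import Data.Nat.Primality using (Prime; euclidsLemma; prime⇒nonZero; ¬prime[1])
open import Data.Nat.Primality.Factorisation
  using (factorisationHasAllPrimeFactors; factorise; factors; module PrimeFactorisation)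
import Data.Nat.Properties as ℕ
open import Data.Product.Base using (∃-syntax; _×_; _,_; proj₁; proj₂)
open import Data.Sum.Base using (_⊎_; inj₁; inj₂; [_,_]′)
open import Data.Vec.Functional using (Vector; updateAt)
open import Data.Vec.Functional.Properties using (updateAt-updates; updateAt-minimal)
open import Function.Base using (_∘_; const)
open import Function.Bundles using (_⇔_; mk⇔)
open import Level using (0ℓ)
open import Relation.Binary.Definitions using (tri<; tri≈; tri>)
open import Relation.Binary.PropositionalEquality
open import Relation.Nullary.Decidable
  using (Dec; yes; no; ¬?; _×-dec_; does-⇔; dec-true; dec-false; decidable-stable)
open import Relation.Nullary.Negation using (¬_; contradiction)
open import Relation.Unary using (Pred; Decidable)

open import Algebra.Properties.CommutativeMonoid.Sum ℤ.+-0-commutativeMonoid using (sum)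

-- Divisibility of integer combinations and least residues

∣-comb₁ : ∀ {k a x} u → k ∣ᶻ a → x ≡ u * a → k ∣ᶻ x
∣-comb₁ u k∣a refl = ∣n⇒∣m*n u k∣a

-- The congruence arguments below mostly take this form: two known divisibilities and one polynomial
-- identity.
∣-comb₂ : ∀ {k a b x} u v → k ∣ᶻ a → k ∣ᶻ b → x ≡ u * a + v * b → k ∣ᶻ x
∣-comb₂ u v k∣a k∣b refl = ∣m∣n⇒∣m+n (∣n⇒∣m*n u k∣a) (∣n⇒∣m*n v k∣b)

module _ {n : ℕ} .{{_ : NonZero n}} where

  residue : ℤ → Fin n
  residue x = fromℕ< (n%ℕd<d x n)

  ∣x-residue : ∀ x → + n ∣ᶻ x - + toℕ (residue x)
  ∣x-residue x = divides (x /ℕ n) (begin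
    x - + toℕ (residue x)                     ≡⟨ cong (λ r → x - + r) (toℕ-fromℕ< (n%ℕd<d x n)) ⟩
    x - + (x %ℕ n)                            ≡⟨ cong (_- + (x %ℕ n)) (a≡a%ℕn+[a/ℕn]*n x n) ⟩
    + (x %ℕ n) + (x /ℕ n) * + n - + (x %ℕ n)  ≡⟨ cancel (+ (x %ℕ n)) _ ⟩
    (x /ℕ n) * + n                            ∎)
    where
    open ≡-Reasoning
    cancel : ∀ a b → a + b - a ≡ b
    cancel = solve-∀

  residue-≡⇒∣ : ∀ {x y} → residue x ≡ residue y → + n ∣ᶻ x - y
  residue-≡⇒∣ {x} {y} eq = ∣-comb₂ 1ℤ -1ℤ (∣x-residue x)
    (subst (λ r → + n ∣ᶻ y - + toℕ r) (sym eq) (∣x-residue y)) (lemma x y _)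
    where
    lemma : ∀ x y r → x - y ≡ 1ℤ * (x - r) + -1ℤ * (y - r)
    lemma = solve-∀

∣∧<⇒≡0 : ∀ {n m} → + n ∣ᶻ + m → m ℕ.< n → m ≡ 0
∣∧<⇒≡0 {m = zero}  n∣m m<n = refl
∣∧<⇒≡0 {m = suc m} n∣m m<n = contradiction (ℕ∣.∣⇒≤ (∣⇒∣ᵤ n∣m)) (ℕ.<⇒≱ m<n)

∣-∸⇒≡ : ∀ {n} {i j : Fin n} → + n ∣ᶻ + toℕ i - + toℕ j → i ≡ j
∣-∸⇒≡ {n} {i} {j} n∣ = toℕ-injective (from-≤ (ℕ.≤-total (toℕ i) (toℕ j)))
  where
  below : ∀ a b → a ≤ b → b ℕ.< n → + n ∣ᶻ + b - + a → a ≡ b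
  below a b a≤b b<n d = ℕ.≤-antisym a≤b (ℕ.m∸n≡0⇒m≤n (∣∧<⇒≡0 (subst (+ n ∣ᶻ_) eq d) (ℕ.≤-<-trans (ℕ.m∸n≤m b a) b<n)))
    where
    eq : + b - + a ≡ + (b ℕ.∸ a)
    eq = trans (ℤ.m-n≡m⊖n b a) (ℤ.⊖-≥ a≤b)
  from-≤ : toℕ i ≤ toℕ j ⊎ toℕ j ≤ toℕ i → toℕ i ≡ toℕ j
  from-≤ (inj₁ i≤j) = below _ _ i≤j (toℕ<n j) (∣-comb₁ -1ℤ n∣ (lemma (+ toℕ i) (+ toℕ j)))
    where
    lemma : ∀ a b → b - a ≡ -1ℤ * (a - b)
    lemma = solve-∀
  from-≤ (inj₂ j≤i) = sym (below _ _ j≤i (toℕ<n i) n∣)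

-- Quadratic forms and Legendre symbols modulo a prime

module ModPrime {p : ℕ} (pr : Prime p) where

  private instance
    p≢0 : NonZero p
    p≢0 = prime⇒nonZero pr

  Z : ℤ → Set
  Z x = + p ∣ᶻ x

  Z? : ∀ x → Dec (Z x)
  Z? x = + p ∣? x

  Z-0 : Z 0ℤ
  Z-0 = divides 0ℤ refl

  Z-euclid : ∀ a b → Z (a * b) → Z a ⊎ Z b
  Z-euclid a b ab with euclidsLemma _ _ pr (subst (p ∣_) (ℤ.abs-* a b) (∣⇒∣ᵤ ab))
  ... | inj₁ d = inj₁ (∣ᵤ⇒∣ d)
  ... | inj₂ d = inj₂ (∣ᵤ⇒∣ d)

  ¬Z-* : ∀ {a b} → ¬ Z a → ¬ Z b → ¬ Z (a * b)
  ¬Z-* {a} {b} ¬a ¬b ab = [ ¬a , ¬b ]′ (Z-euclid a b ab)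

  ¬Z-factorʳ : ∀ {a b c} → ¬ Z c → Z (a * b - c) → ¬ Z b
  ¬Z-factorʳ {a} {b} {c} ¬c d zb = ¬c (∣-comb₂ a -1ℤ zb d (lemma a b c))
    where
    lemma : ∀ a b c → c ≡ a * b + -1ℤ * (a * b - c)
    lemma = solve-∀

  Z-inverse : ∀ {a} → ¬ Z a → ∃[ x ] Z (a * x - 1ℤ)
  Z-inverse {a} ¬a = inverse
    where
    r = a %ℕ p
    q = a /ℕ p
    a≡ : a ≡ + r + q * + p
    a≡ = a≡a%ℕn+[a/ℕn]*n a p
    instance
      r≢0 : NonZero r
      r≢0 = ℕ.≢-nonZero λ r≡0 → ¬a (divides q (trans a≡ (trans (cong (λ t → + t + q * + p) r≡0) (ℤ.+-identityˡ _))))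
    pos : ∀ x y z w → 1 ℕ.+ x ℕ.* y ≡ z ℕ.* w → 1ℤ + + x * + y ≡ + z * + w
    pos x y z w eq = trans (cong (λ t → 1ℤ + t) (sym (ℤ.pos-* x y))) (trans (cong +_ eq) (ℤ.pos-* z w))
    lemma : ∀ r q x y p → 1ℤ + x * p ≡ y * r → (r + q * p) * y - 1ℤ ≡ (x + q * y) * p
    lemma r q x y p eq = trans (regroup r q y p) (trans (cong (λ t → t + q * y * p - 1ℤ) (sym eq)) (finish x p q y))
      where
      regroup : ∀ r q y p → (r + q * p) * y - 1ℤ ≡ y * r + q * y * p - 1ℤ
      regroup = solve-∀
      finish : ∀ x p q y → 1ℤ + x * p + q * y * p - 1ℤ ≡ (x + q * y) * p
      finish = solve-∀
    lemma′ : ∀ r q x y p → 1ℤ + y * r ≡ x * p → (r + q * p) * (- y) - 1ℤ ≡ (- x - q * y) * p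
    lemma′ r q x y p eq = trans (regroup r q y p) (trans (cong (λ t → - t - q * y * p) eq) (finish x p q y))
      where
      regroup : ∀ r q y p → (r + q * p) * (- y) - 1ℤ ≡ - (1ℤ + y * r) - q * y * p
      regroup = solve-∀
      finish : ∀ x p q y → - (x * p) - q * y * p ≡ (- x - q * y) * p
      finish = solve-∀
    inverse : ∃[ x ] Z (a * x - 1ℤ)
    inverse with coprime-Bézout (prime⇒coprime pr (n%ℕd<d a p))
    -- The Bézout identity for p and r over the naturals has two forms, according to which side
    -- carries the 1. Here 1 + y r = x p, so r has inverse -y.
    ... | Bézout.+- x y eq = - + y , divides (- + x - q * + y)
          (trans (cong (λ t → t * (- + y) - 1ℤ) a≡) (lemma′ (+ r) q (+ x) (+ y) (+ p) (pos y r x p eq)))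
    ... | Bézout.-+ x y eq = + y , divides (+ x + q * + y)
          (trans (cong (λ t → t * + y - 1ℤ) a≡) (lemma (+ r) q (+ x) (+ y) (+ p) (pos x p y r eq)))

  Z-divide : ∀ {a} → ¬ Z a → ∀ b → ∃[ x ] Z (a * x - b)
  Z-divide {a} ¬a b with Z-inverse ¬a
  ... | x , d = x * b , ∣-comb₁ b d (lemma a x b)
    where
    lemma : ∀ a x b → a * (x * b) - b ≡ b * (a * x - 1ℤ)
    lemma = solve-∀

  private
    h = p ℕ./ 2

    -- Two families indexed by 0, ..., h together outnumber the residues modulo p.
    p<2[1+h] : p ℕ.< suc h ℕ.+ suc h
    p<2[1+h] = begin-strict
      p                            ≡⟨ m≡m%n+[m/n]*n p 2 ⟩
      p ℕ.% 2 ℕ.+ h ℕ.* 2          <⟨ ℕ.+-monoˡ-< (h ℕ.* 2) (m%n<n p 2) ⟩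
      2 ℕ.+ h ℕ.* 2                ≡⟨ ℕ.*-comm (suc h) 2 ⟩
      suc h ℕ.+ (suc h ℕ.+ 0)      ≡⟨ cong (suc h ℕ.+_) (ℕ.+-identityʳ (suc h)) ⟩
      suc h ℕ.+ suc h              ∎
      where open ℕ.≤-Reasoning

    2h≤p : h ℕ.+ h ≤ p
    2h≤p = begin
      h ℕ.+ h          ≡⟨ cong (h ℕ.+_) (ℕ.+-identityʳ h) ⟨
      h ℕ.+ (h ℕ.+ 0)  ≡⟨ ℕ.*-comm 2 h ⟩
      h ℕ.* 2          ≤⟨ m/n*n≤m p 2 ⟩
      p                ∎
      where open ℕ.≤-Reasoning

    -- In b² - a² = (b - a)(b + a) both factors are positive and smaller than p.
    squares-distinct : ∀ a b → a ℕ.< b → b ≤ h → ¬ Z (+ b * + b - + a * + a)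
    squares-distinct a b a<b b≤h d with Z-euclid (+ (b ℕ.∸ a)) (+ (b ℕ.+ a)) (subst Z eq d)
      where
      eq : + b * + b - + a * + a ≡ + (b ℕ.∸ a) * + (b ℕ.+ a)
      eq = trans (factor (+ b) (+ a)) (cong (_* + (b ℕ.+ a)) (trans (ℤ.m-n≡m⊖n b a) (ℤ.⊖-≥ (ℕ.<⇒≤ a<b))))
        where
        factor : ∀ b a → b * b - a * a ≡ (b - a) * (b + a)
        factor = solve-∀
    ... | inj₁ d′ = contradiction (∣∧<⇒≡0 d′ lt) (ℕ.m>n⇒m∸n≢0 a<b)
      where
      lt : b ℕ.∸ a ℕ.< p
      lt = ℕ.≤-<-trans (ℕ.m∸n≤m b a) (ℕ.<-≤-trans (ℕ.m<m+n b (ℕ.≤-trans (s≤s z≤n) (ℕ.≤-trans a<b b≤h)))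
             (ℕ.≤-trans (ℕ.+-monoˡ-≤ h b≤h) 2h≤p))
    ... | inj₂ d′ with ∣∧<⇒≡0 d′ (ℕ.<-≤-trans (ℕ.+-mono-≤-< b≤h (ℕ.<-≤-trans a<b b≤h)) 2h≤p)
    ...   | eq = contradiction (ℕ.m+n≡0⇒m≡0 b eq) (ℕ.m<n⇒n≢0 a<b)

    half-squares-injective : (i j : Fin (suc h)) → Z (+ toℕ i * + toℕ i - + toℕ j * + toℕ j) → i ≡ j
    half-squares-injective i j d with ℕ.<-cmp (toℕ i) (toℕ j)
    ... | tri≈ _ eq _ = toℕ-injective eq
    ... | tri< lt _ _ = contradiction (∣-comb₁ -1ℤ d (negate (+ toℕ i * + toℕ i) (+ toℕ j * + toℕ j)))
                          (squares-distinct _ _ lt (ℕ.s≤s⁻¹ (toℕ<n j)))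
      where
      negate : ∀ a b → b - a ≡ -1ℤ * (a - b)
      negate = solve-∀
    ... | tri> _ _ gt = contradiction d (squares-distinct _ _ gt (ℕ.s≤s⁻¹ (toℕ<n i)))

  -- The sets {A x²} and {t - B y²} have (p + 1) / 2 elements each, so they meet.
  binary-form : ∀ {A B} → ¬ Z A → ¬ Z B → ∀ t → ∃[ x ] ∃[ y ] Z (A * (x * x) + B * (y * y) - t)
  binary-form {A} {B} ¬A ¬B t = from-collision (pigeonhole p<2[1+h] (residue ∘ value ∘ splitAt (suc h)))
    where
    value : Fin (suc h) ⊎ Fin (suc h) → ℤ
    value (inj₁ i) = A * (+ toℕ i * + toℕ i)
    value (inj₂ j) = t - B * (+ toℕ j * + toℕ j)
    Solution : Set
    Solution = ∃[ x ] ∃[ y ] Z (A * (x * x) + B * (y * y) - t)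
    solution : ∀ u v → u ≢ v → Z (value u - value v) → Solution
    solution (inj₁ i) (inj₂ j) _ d = + toℕ i , + toℕ j , ∣-comb₁ 1ℤ d (lemma (A * _) t (B * _))
      where
      lemma : ∀ u t v → u + v - t ≡ 1ℤ * (u - (t - v))
      lemma = solve-∀
    solution (inj₂ j) (inj₁ i) _ d = + toℕ i , + toℕ j , ∣-comb₁ -1ℤ d (lemma (A * _) t (B * _))
      where
      lemma : ∀ u t v → u + v - t ≡ -1ℤ * (t - v - u)
      lemma = solve-∀
    -- A collision within one family is excluded: the unit A, or B in the next case, cancels and
    -- leaves two equal squares of elements of 0, ..., h.
    solution (inj₁ i) (inj₁ j) i≢j d = contradiction (cong inj₁ (half-squares-injective i j
      ([ (λ z → contradiction z ¬A) , (λ z → z) ]′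
        (Z-euclid A _ (subst Z (lemma A (+ toℕ i * + toℕ i) (+ toℕ j * + toℕ j)) d))))) i≢j
      where
      lemma : ∀ A u v → A * u - A * v ≡ A * (u - v)
      lemma = solve-∀
    solution (inj₂ i) (inj₂ j) i≢j d = contradiction (cong inj₂ (sym (half-squares-injective j i
      ([ (λ z → contradiction z ¬B) , (λ z → z) ]′
        (Z-euclid B _ (subst Z (lemma t B (+ toℕ i * + toℕ i) (+ toℕ j * + toℕ j)) d)))))) i≢j
      where
      lemma : ∀ t B u v → t - B * u - (t - B * v) ≡ B * (v - u)
      lemma = solve-∀
    from-collision :
      (∃[ i ] ∃[ j ] i Fin.< j × residue {p} (value (splitAt (suc h) i)) ≡ residue (value (splitAt (suc h) j))) →
      Solution
    from-collision (i , j , i<j , eq) = solution (splitAt (suc h) i) (splitAt (suc h) j)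
      (λ eq′ → ℕ.<-irrefl (cong toℕ (trans (sym (join-splitAt (suc h) (suc h) i))
        (trans (cong (join (suc h) (suc h)) eq′) (join-splitAt (suc h) (suc h) j)))) i<j)
      (residue-≡⇒∣ {p} {value (splitAt (suc h) i)} {value (splitAt (suc h) j)} eq)

  module LargePrime (7≤p : 7 ≤ p) where

    ¬Z-small : ∀ m → suc m ℕ.< 7 → ¬ Z (+ suc m)
    ¬Z-small m lt d with ∣∧<⇒≡0 d (ℕ.<-≤-trans lt 7≤p)
    ... | ()

    ¬Z-1 : ¬ Z 1ℤ
    ¬Z-1 = ¬Z-small 0 (ℕ.s≤s (ℕ.s≤s z≤n))

    ¬Z-2 : ¬ Z (+ 2)
    ¬Z-2 = ¬Z-small 1 (ℕ.s≤s (ℕ.s≤s (ℕ.s≤s z≤n)))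

    ¬Z-3 : ¬ Z (+ 3)
    ¬Z-3 = ¬Z-small 2 (ℕ.s≤s (ℕ.s≤s (ℕ.s≤s (ℕ.s≤s z≤n))))

    ¬Z-5 : ¬ Z (+ 5)
    ¬Z-5 = ¬Z-small 4 (ℕ.s≤s (ℕ.s≤s (ℕ.s≤s (ℕ.s≤s (ℕ.s≤s (ℕ.s≤s z≤n))))))

    private
      -- The slopes unfit for `second-point`. If A + B m² vanishes, the line through (0, y₀) has no
      -- second point on the conic; if A - B m² vanishes, the second point has y-coordinate 0.
      Bad : ℤ → ℤ → ℤ → Set
      Bad A B m = Z (A + B * (m * m)) ⊎ Z (A + (- B) * (m * m))

      clash : ∀ {A C a b} → ¬ Z C → ¬ Z (a - b) → Z (A + C * a) → Z (A + C * b) → ⊥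
      clash {A} {C} {a} {b} ¬C ¬ab za zb =
        ¬Z-* ¬C ¬ab (∣-comb₂ 1ℤ -1ℤ za zb (lemma A C a b))
        where
        lemma : ∀ A C a b → C * (a - b) ≡ 1ℤ * (A + C * a) + -1ℤ * (A + C * b)
        lemma = solve-∀

      ¬Z-neg : ∀ {a} → ¬ Z a → ¬ Z (- a)
      ¬Z-neg {a} ¬a z = ¬a (∣-comb₁ -1ℤ z (lemma a))
        where
        lemma : ∀ a → a ≡ -1ℤ * (- a)
        lemma = solve-∀

      ¬Z-8 : ¬ Z (+ 8)
      ¬Z-8 = ¬Z-* {+ 2} {+ 4} ¬Z-2 (¬Z-* {+ 2} {+ 2} ¬Z-2 ¬Z-2)

      -- The squares 1, 4 and 9 are distinct modulo p, and only two values of m² are bad.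
      slope : ∀ A {B} → ¬ Z B → ∃[ m ] ¬ Z m × ¬ Bad A B m
      slope A {B} ¬B with bad? 1ℤ | bad? (+ 2) | bad? (+ 3)
        where
        bad? : ∀ m → Dec (Bad A B m)
        bad? m with Z? (A + B * (m * m)) | Z? (A + (- B) * (m * m))
        ... | yes z | _     = yes (inj₁ z)
        ... | no _  | yes z = yes (inj₂ z)
        ... | no ¬z | no ¬w = no [ ¬z , ¬w ]′
      ... | no ¬b₁ | _ | _ = 1ℤ , ¬Z-1 , ¬b₁
      ... | yes _ | no ¬b₂ | _ = + 2 , ¬Z-2 , ¬b₂
      ... | yes _ | yes _ | no ¬b₃ = + 3 , ¬Z-3 , ¬b₃
      ... | yes b₁ | yes b₂ | yes b₃ = ⊥-elim (impossible b₁ b₂ b₃)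
        where
        impossible : Bad A B 1ℤ → Bad A B (+ 2) → Bad A B (+ 3) → ⊥
        -- Two of the three slopes fail for the same sign of B. Subtracting their congruences shows
        -- that p divides B times a difference of two of 1, 4 and 9, that is 3, 5 or 8 up to sign.
        impossible (inj₁ x) (inj₁ y) _        = clash {A} {B} {+ 4} {+ 1} ¬B ¬Z-3 y x
        impossible (inj₁ x) (inj₂ _) (inj₁ z) = clash {A} {B} {+ 9} {+ 1} ¬B ¬Z-8 z x
        impossible (inj₁ _) (inj₂ y) (inj₂ z) = clash {A} { - B} {+ 9} {+ 4} (¬Z-neg ¬B) ¬Z-5 z y
        impossible (inj₂ x) (inj₂ y) _        = clash {A} { - B} {+ 4} {+ 1} (¬Z-neg ¬B) ¬Z-3 y x
        impossible (inj₂ x) (inj₁ _) (inj₂ z) = clash {A} { - B} {+ 9} {+ 1} (¬Z-neg ¬B) ¬Z-8 z x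
        impossible (inj₂ _) (inj₁ y) (inj₁ z) = clash {A} {B} {+ 9} {+ 4} ¬B ¬Z-5 z y

      -- The line of slope m through the point (0, y₀) meets the conic again.
      second-point : ∀ {A B t y₀} → ¬ Z B → ¬ Z y₀ → Z (B * (y₀ * y₀) - t) →
        ∃[ x ] ∃[ y ] ¬ Z x × ¬ Z y × Z (A * (x * x) + B * (y * y) - t)
      second-point {A} {B} {t} {y₀} ¬B ¬y₀ on with slope A ¬B
      ... | m , ¬m , ¬bad with Z-inverse (¬bad ∘ inj₁)
      -- On the line the equation reduces to (A + B m²) x = 2 B y₀ m once the root x = 0 is divided
      -- out, and D inverts the coefficient of x.
      ...   | D , inv = (+ 2) * B * y₀ * m * D , y₀ * (A + (- B) * (m * m)) * D ,
            ¬Z-* (¬Z-* (¬Z-* (¬Z-* ¬Z-2 ¬B) ¬y₀) ¬m) ¬D ,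
            ¬Z-* (¬Z-* ¬y₀ (¬bad ∘ inj₂)) ¬D ,
            ∣-comb₂ 1ℤ (B * (y₀ * y₀) * ((A + B * (m * m)) * D + 1ℤ)) on inv
              (lemma A B t y₀ m D)
        where
        lemma : ∀ A B t y m D → let x′ = (+ 2) * B * y * m * D ; y′ = y * (A + (- B) * (m * m)) * D in
          A * (x′ * x′) + B * (y′ * y′) - t ≡
          1ℤ * (B * (y * y) - t) + B * (y * y) * ((A + B * (m * m)) * D + 1ℤ) * ((A + B * (m * m)) * D - 1ℤ)
        lemma = solve-∀
        ¬D : ¬ Z D
        ¬D = ¬Z-factorʳ {A + B * (m * m)} {D} ¬Z-1 inv

    -- Since t is nonzero, a solution has at most one zero coordinate, and `second-point` trades
    -- such a solution for one without zero coordinates.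
    binary-form-units : ∀ {A B t} → ¬ Z A → ¬ Z B → ¬ Z t →
      ∃[ x ] ∃[ y ] ¬ Z x × ¬ Z y × Z (A * (x * x) + B * (y * y) - t)
    binary-form-units {A} {B} {t} ¬A ¬B ¬t = from-solution (binary-form ¬A ¬B t)
      where
      drop₁ : ∀ A x b t → b - t ≡ 1ℤ * (A * (x * x) + b - t) + (- (A * x)) * x
      drop₁ = solve-∀
      drop₂ : ∀ B y a t → a - t ≡ 1ℤ * (a + B * (y * y) - t) + (- (B * y)) * y
      drop₂ = solve-∀
      unit : ∀ {C t} → ¬ Z t → ∀ w → Z (C * (w * w) - t) → ¬ Z w
      unit {C} {t} ¬t w on zw = ¬t (∣-comb₂ {a = w} (C * w) -1ℤ zw on (lemma C t w))
        where
        lemma : ∀ B t y → t ≡ B * y * y + -1ℤ * (B * (y * y) - t)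
        lemma = solve-∀
      Solution : Set
      Solution = ∃[ x ] ∃[ y ] ¬ Z x × ¬ Z y × Z (A * (x * x) + B * (y * y) - t)
      by-cases : ∀ x y → Z (A * (x * x) + B * (y * y) - t) → Dec (Z x) → Dec (Z y) → Solution
      by-cases x y on (no ¬x) (no ¬y) = x , y , ¬x , ¬y , on
      by-cases x y on (yes zx) _      = second-point {A} {B} {t} {y} ¬B (unit {B} {t} ¬t y on′) on′
        where
        on′ : Z (B * (y * y) - t)
        on′ = ∣-comb₂ {b = x} 1ℤ (- (A * x)) on zx (drop₁ A x (B * (y * y)) t)
      by-cases x y on (no ¬x) (yes zy) = swap (second-point {B} {A} {t} {x} ¬A ¬x on′)
        where
        on′ : Z (A * (x * x) - t)
        on′ = ∣-comb₂ {b = y} 1ℤ (- (B * y)) on zy (drop₂ B y (A * (x * x)) t)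
        swap : (∃[ y ] ∃[ x ] ¬ Z y × ¬ Z x × Z (B * (y * y) + A * (x * x) - t)) → Solution
        swap (y , x , ¬y , ¬x , on) = x , y , ¬x , ¬y ,
          subst (λ s → Z (s - t)) (ℤ.+-comm (B * (y * y)) (A * (x * x))) on
      from-solution : (∃[ x ] ∃[ y ] Z (A * (x * x) + B * (y * y) - t)) → Solution
      from-solution (x , y , on) = by-cases x y on (Z? x) (Z? y)

    -- One of z = 1 and z = 2 makes t - C z² nonzero, because the two values differ by 3 C. The
    -- binary form then represents t - C z².
    ternary-form-units : ∀ {A B C} → ¬ Z A → ¬ Z B → ¬ Z C → ∀ t →
      ∃[ x ] ∃[ y ] ∃[ z ] ¬ Z x × ¬ Z y × ¬ Z z × Z (A * (x * x) + B * (y * y) + C * (z * z) - t)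
    ternary-form-units {A} {B} {C} ¬A ¬B ¬C t = by-cases (Z? (t - C * (1ℤ * 1ℤ)))
      where
      extend : ∀ z → ¬ Z z → ¬ Z (t - C * (z * z)) →
        ∃[ x ] ∃[ y ] ∃[ z ] ¬ Z x × ¬ Z y × ¬ Z z × Z (A * (x * x) + B * (y * y) + C * (z * z) - t)
      extend z ¬z ¬t′ = append (binary-form-units {A} {B} {t - C * (z * z)} ¬A ¬B ¬t′)
        where
        lemma : ∀ a b t c → a + b - (t - c) ≡ a + b + c - t
        lemma = solve-∀
        append : (∃[ x ] ∃[ y ] ¬ Z x × ¬ Z y × Z (A * (x * x) + B * (y * y) - (t - C * (z * z)))) →
          ∃[ x ] ∃[ y ] ∃[ z ] ¬ Z x × ¬ Z y × ¬ Z z × Z (A * (x * x) + B * (y * y) + C * (z * z) - t)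
        append (x , y , ¬x , ¬y , on) = x , y , z , ¬x , ¬y , ¬z ,
          subst Z (lemma (A * (x * x)) (B * (y * y)) t (C * (z * z))) on
      difference : ∀ C t → + 3 * C ≡ 1ℤ * (t - C * (1ℤ * 1ℤ)) + -1ℤ * (t - C * (+ 2 * + 2))
      difference = solve-∀
      by-cases : Dec (Z (t - C * (1ℤ * 1ℤ))) →
        ∃[ x ] ∃[ y ] ∃[ z ] ¬ Z x × ¬ Z y × ¬ Z z × Z (A * (x * x) + B * (y * y) + C * (z * z) - t)
      by-cases (no ¬t′) = extend 1ℤ ¬Z-1 ¬t′
      by-cases (yes zt′) = extend (+ 2) ¬Z-2 λ z → ¬Z-* {+ 3} {C} ¬Z-3 ¬C (∣-comb₂ 1ℤ -1ℤ zt′ z (difference C t))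

    -- `QuadraticResidue` wants its root among the least residues, so an integer root is first
    -- reduced modulo p.
    toQuadraticResidue : ∀ y {a} → Z (y * y - a) → QuadraticResidue a p
    toQuadraticResidue y {a} d = residue y ,
      ∣-comb₂ 1ℤ (- (y + + toℕ (residue y))) d (∣x-residue y) (lemma y (+ toℕ (residue y)) a)
      where
      lemma : ∀ y r a → r * r - a ≡ 1ℤ * (y * y - a) + (- (y + r)) * (y - r)
      lemma = solve-∀

    -- If every residue had a square root, a choice of roots would be a permutation
    -- missing one of 1 and -1.
    nonresidue : ∃[ ν ] ¬ QuadraticResidue ν p
    nonresidue with any? (λ a → ¬? (quadraticResidue? (+ toℕ {p} a) p))
    ... | yes (a , ¬q) = + toℕ a , ¬q
    ... | no none = ⊥-elim (absurd (pigeonhole (ℕ.n<1+n p) roots))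
      where
      qr : ∀ a → QuadraticResidue (+ toℕ {p} a) p
      qr a = decidable-stable (quadraticResidue? (+ toℕ a) p) (λ ¬q → none (a , ¬q))
      root : Fin p → Fin p
      root a = proj₁ (qr a)
      root-injective : ∀ a b → root a ≡ root b → a ≡ b
      root-injective a b eq = ∣-∸⇒≡ (∣-comb₂ -1ℤ 1ℤ (proj₂ (qr a))
        (subst (λ r → Z (+ toℕ r * + toℕ r - + toℕ b)) (sym eq) (proj₂ (qr b)))
        (lemma (+ toℕ a) (+ toℕ b) (+ toℕ (root a) * + toℕ (root a))))
        where
        lemma : ∀ a b s → a - b ≡ -1ℤ * (s - a) + 1ℤ * (s - b)
        lemma = solve-∀
      one = residue {p} 1ℤ
      root-of-one : ∀ {a} ε → ε * ε ≡ 1ℤ → residue {p} ε ≡ root a → a ≡ one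
      root-of-one {a} ε ε² eq = ∣-∸⇒≡ (∣-comb₂ 1ℤ -1ℤ (∣x-residue 1ℤ) q (lemma (+ toℕ a) (+ toℕ one)))
        where
        lemma : ∀ a o → a - o ≡ 1ℤ * (1ℤ - o) + -1ℤ * (1ℤ - a)
        lemma = solve-∀
        rearrange : ∀ e r a → e * e - a ≡ (e + r) * (e - r) + 1ℤ * (r * r - a)
        rearrange = solve-∀
        r = + toℕ (residue {p} ε)
        q : Z (1ℤ - + toℕ a)
        q = subst (λ s → Z (s - + toℕ a)) ε² (∣-comb₂ (ε + r) 1ℤ (∣x-residue ε)
              (subst (λ s → Z (+ toℕ s * + toℕ s - + toℕ a)) (sym eq) (proj₂ (qr a)))
              (rearrange ε r (+ toℕ a)))
      missed : ∃[ v ] ∀ a → v ≢ root a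
      -- Each of 1 and -1 can be the chosen root of 1 only, and 1 has a single chosen root. Since 1
      -- and -1 differ modulo p, one of them is never chosen.
      missed with root one Fin.≟ one
      ... | yes eq = residue {p} -1ℤ , λ a v≡ → ¬Z-neg ¬Z-2 (residue-≡⇒∣ {p} {x = -1ℤ} {y = 1ℤ}
              (trans v≡ (trans (cong root (root-of-one {a} -1ℤ refl v≡)) eq)))
      ... | no neq = one , λ a v≡ → neq (sym (trans v≡ (cong root (root-of-one {a} 1ℤ refl v≡))))
      -- The missed residue in front of the injective list of roots would give p + 1 distinct
      -- residues.
      roots : Fin (suc p) → Fin p
      roots zero    = proj₁ missed
      roots (suc a) = root a
      absurd : ¬ (∃[ i ] ∃[ j ] i Fin.< j × roots i ≡ roots j)
      absurd (zero  , suc j , _ , eq) = proj₂ missed j eq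
      absurd (suc i , suc j , s≤s i<j , eq) = ℕ.<-irrefl (cong toℕ (root-injective i j eq)) i<j

    legendre-cong-⇔ : ∀ {a b} → Z a ⇔ Z b → QuadraticResidue a p ⇔ QuadraticResidue b p →
      legendre a p ≡ legendre b p
    legendre-cong-⇔ {a} {b} z q = cong₂ (λ s t → if s then 0ℤ else if t then 1ℤ else -1ℤ)
      (does-⇔ z (Z? a) (Z? b)) (does-⇔ q (quadraticResidue? a p) (quadraticResidue? b p))

    legendre-cong : ∀ {a b} → Z (a - b) → legendre a p ≡ legendre b p
    legendre-cong {a} {b} d = legendre-cong-⇔
      (mk⇔ (λ z → ∣-comb₂ 1ℤ -1ℤ z d (l₃ a b))
           (λ z → ∣-comb₂ 1ℤ 1ℤ z d (l₄ a b)))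
      (mk⇔ (λ (y , q) → y , ∣-comb₂ 1ℤ 1ℤ q d (l₁ (+ toℕ y * + toℕ y) a b))
           (λ (y , q) → y , ∣-comb₂ 1ℤ -1ℤ q d (l₂ (+ toℕ y * + toℕ y) a b)))
      where
      l₂ : ∀ s a b → s - a ≡ 1ℤ * (s - b) + -1ℤ * (a - b)
      l₂ = solve-∀
      l₁ : ∀ s a b → s - b ≡ 1ℤ * (s - a) + 1ℤ * (a - b)
      l₁ = solve-∀
      l₄ : ∀ a b → a ≡ 1ℤ * b + 1ℤ * (a - b)
      l₄ = solve-∀
      l₃ : ∀ a b → b ≡ 1ℤ * a + -1ℤ * (a - b)
      l₃ = solve-∀

    -- Multiplication by x and by its inverse carries square roots of a to square roots of a x² and
    -- back.
    legendre-*-square : ∀ a {x} → ¬ Z x → legendre (a * (x * x)) p ≡ legendre a p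
    legendre-*-square a {x} ¬x with Z-inverse ¬x
    ... | D , inv = legendre-cong-⇔
      (mk⇔ (λ z → decidable-stable (Z? a) λ ¬a → ¬Z-* ¬a (¬Z-* ¬x ¬x) z)
           (λ z → ∣-comb₁ (x * x) z (ℤ.*-comm a (x * x))))
      (mk⇔ (λ (y , q) → toQuadraticResidue (+ toℕ y * D)
             (∣-comb₂ (D * D) (a * (x * D + 1ℤ)) q inv (l₁ (+ toℕ y) a x D)))
           (λ (y , q) → toQuadraticResidue (+ toℕ y * x) (∣-comb₁ (x * x) q (l₂ (+ toℕ y) a x))))
      where
      l₂ : ∀ y a x → y * x * (y * x) - a * (x * x) ≡ x * x * (y * y - a)
      l₂ = solve-∀
      l₁ : ∀ y a x D → y * D * (y * D) - a ≡ D * D * (y * y - a * (x * x)) + a * (x * D + 1ℤ) * (x * D - 1ℤ)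
      l₁ = solve-∀

    legendre-residue : ∀ {a} → ¬ Z a → QuadraticResidue a p → legendre a p ≡ 1ℤ
    legendre-residue {a} ¬a q
      rewrite dec-false (Z? a) ¬a | dec-true (quadraticResidue? a p) q = refl

    legendre-nonresidue : ∀ {a} → ¬ Z a → ¬ QuadraticResidue a p → legendre a p ≡ -1ℤ
    legendre-nonresidue {a} ¬a ¬q
      rewrite dec-false (Z? a) ¬a | dec-false (quadraticResidue? a p) ¬q = refl

    legendre-zero : ∀ {a} → Z a → legendre a p ≡ 0ℤ
    legendre-zero {a} za rewrite dec-true (Z? a) za = refl

-- Zero-sums modulo a prime with prescribed Legendre symbols

dot : ∀ {k} → Vector ℤ k → Vector ℤ k → ℤ
dot d y = sum λ i → d i * y i

_[_]≔_ : ∀ {k} → Vector ℤ k → Fin k → ℤ → Vector ℤ k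
d [ i ]≔ v = updateAt d i (const v)

dot-update : ∀ {k} (d y : Vector ℤ k) i v → dot (d [ i ]≔ v) y ≡ dot d y + (v - d i) * y i
dot-update d y zero v = lemma (d zero) v (y zero) _
  where
  lemma : ∀ d v y s → v * y + s ≡ d * y + s + (v - d) * y
  lemma = solve-∀
dot-update d y (suc i) v = trans
  (cong (λ s → d zero * y zero + s) (dot-update (d ∘ suc) (y ∘ suc) i v))
  (sym (ℤ.+-assoc (d zero * y zero) _ _))

∣-dot : ∀ {m k} (d y : Vector ℤ k) → (∀ i → m ∣ᶻ d i ⊎ m ∣ᶻ y i) → m ∣ᶻ dot d y
∣-dot {k = zero}  d y m∣ = ∣n⇒∣m*n 0ℤ {n = 0ℤ} (divides 0ℤ refl)
∣-dot {k = suc k} d y m∣ = ∣m∣n⇒∣m+n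
  ([ ∣m⇒∣m*n (y zero) , ∣n⇒∣m*n (d zero) ]′ (m∣ zero)) (∣-dot (d ∘ suc) (y ∘ suc) (m∣ ∘ suc))

update-same : ∀ {k} (d : Vector ℤ k) i v → (d [ i ]≔ v) i ≡ v
update-same d i v = updateAt-updates i d

update-other : ∀ {k} (d : Vector ℤ k) {i j} v → j ≢ i → (d [ i ]≔ v) j ≡ d j
update-other d {i} {j} v = updateAt-minimal j i d

IsSign : ℤ → Set
IsSign s = s ≡ 1ℤ ⊎ s ≡ -1ℤ

IsSign-* : ∀ {s t} → IsSign s → IsSign t → IsSign (s * t)
IsSign-* (inj₁ refl) (inj₁ refl) = inj₁ refl
IsSign-* (inj₁ refl) (inj₂ refl) = inj₂ refl
IsSign-* (inj₂ refl) (inj₁ refl) = inj₂ refl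
IsSign-* (inj₂ refl) (inj₂ refl) = inj₁ refl

IsSign-*-cancelʳ : ∀ {s a b} → IsSign s → a * s ≡ b * s → a ≡ b
IsSign-*-cancelʳ {a = a} {b} (inj₁ refl) eq = trans (sym (ℤ.*-identityʳ a)) (trans eq (ℤ.*-identityʳ b))
IsSign-*-cancelʳ {a = a} {b} (inj₂ refl) eq = ℤ.*-cancelʳ-≡ a b -1ℤ eq

no-three-in-two : ∀ {A : Set} {i j a b c : A} → a ≢ b → a ≢ c → b ≢ c →
  a ≡ i ⊎ a ≡ j → b ≡ i ⊎ b ≡ j → c ≡ i ⊎ c ≡ j → ⊥
no-three-in-two a≢b a≢c b≢c (inj₁ refl) (inj₁ refl) _ = a≢b refl
no-three-in-two a≢b a≢c b≢c (inj₁ refl) (inj₂ refl) (inj₁ refl) = a≢c refl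
no-three-in-two a≢b a≢c b≢c (inj₁ refl) (inj₂ refl) (inj₂ refl) = b≢c refl
no-three-in-two a≢b a≢c b≢c (inj₂ refl) (inj₂ refl) _ = a≢b refl
no-three-in-two a≢b a≢c b≢c (inj₂ refl) (inj₁ refl) (inj₁ refl) = b≢c refl
no-three-in-two a≢b a≢c b≢c (inj₂ refl) (inj₁ refl) (inj₂ refl) = a≢c refl

third-index : ∀ {k} → 3 ≤ k → (i j : Fin k) → ∃[ l ] l ≢ i × l ≢ j
third-index {1} (s≤s ())
third-index {2} (s≤s (s≤s ()))
third-index {suc (suc (suc k))} _ i j with any? (λ l → ¬? (l Fin.≟ i) ×-dec ¬? (l Fin.≟ j))
... | yes found = found
... | no none = ⊥-elim (no-three-in-two {i = i} {j} {zero} {suc zero} {suc (suc zero)}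
        (λ ()) (λ ()) (λ ()) (taken _) (taken _) (taken _))
  where
  taken : ∀ l → l ≡ i ⊎ l ≡ j
  taken l with l Fin.≟ i | l Fin.≟ j
  ... | yes eq | _      = inj₁ eq
  ... | no _   | yes eq = inj₂ eq
  ... | no ≢i  | no ≢j  = contradiction (l , ≢i , ≢j) none

Lone : ∀ {k} → ℕ → Vector ℤ k → Set
Lone p y = ∃[ i ] ¬ (+ p ∣ᶻ y i) × (∀ j → j ≢ i → + p ∣ᶻ y j)

record Pair {k} (p : ℕ) (y : Vector ℤ k) : Set where
  field
    i j  : Fin k
    i≢j  : i ≢ j
    ∤i   : ¬ (+ p ∣ᶻ y i)
    ∤j   : ¬ (+ p ∣ᶻ y j)
    rest : ∀ l → l ≢ i → l ≢ j → + p ∣ᶻ y l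

  ∤⇒∈ : ∀ l → ¬ (+ p ∣ᶻ y l) → l ≡ i ⊎ l ≡ j
  ∤⇒∈ l ∤l with l Fin.≟ i | l Fin.≟ j
  ... | yes eq | _      = inj₁ eq
  ... | no _   | yes eq = inj₂ eq
  ... | no ≢i  | no ≢j  = contradiction (rest l ≢i ≢j) ∤l

  swap : Pair p y
  swap = record
    { i = j ; j = i ; i≢j = i≢j ∘ sym ; ∤i = ∤j ; ∤j = ∤i ; rest = λ l ≢j ≢i → rest l ≢i ≢j }

-- A Legendre symbol is a sign exactly when its argument is nonzero modulo p, so the first condition
-- asks for unit coefficients.
Solves : ∀ {k} → ℕ → Vector ℤ k → Vector ℤ k → Set
Solves p y d = (∀ i → IsSign (legendre (d i) p)) × + p ∣ᶻ dot d y

Flexible : ∀ {k} → ℕ → Vector ℤ k → Set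
Flexible {k} p y = ∀ (ε : Vector ℤ k) → (∀ i → IsSign (ε i)) →
  ∃[ d ] (∀ i → legendre (d i) p ≡ ε i) × Solves p y d

-- The character at j may come out either way, but `Solves` still makes that coefficient a unit.
FlexibleExcept : ∀ {k} → ℕ → Vector ℤ k → Fin k → Set
FlexibleExcept {k} p y j = ∀ (ε : Vector ℤ k) → (∀ i → IsSign (ε i)) →
  ∃[ d ] (∀ i → i ≢ j → legendre (d i) p ≡ ε i) × Solves p y d

module Support {p : ℕ} (pr : Prime p) {k : ℕ} (y : Vector ℤ k) where
  open ModPrime pr

  Three : Set
  Three = ∃[ i ] ∃[ j ] ∃[ l ] (j ≢ i × l ≢ i × l ≢ j) × ¬ Z (y i) × ¬ Z (y j) × ¬ Z (y l)

  support : (∀ i → Z (y i)) ⊎ Lone p y ⊎ Pair p y ⊎ Three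
  support with any? (λ i → ¬? (Z? (y i)))
  ... | no none = inj₁ λ i → decidable-stable (Z? (y i)) λ ¬z → none (i , ¬z)
  ... | yes (i , ¬Zi) with any? (λ j → ¬? (j Fin.≟ i) ×-dec ¬? (Z? (y j)))
  ...   | no none = inj₂ (inj₁ (i , ¬Zi , λ j j≢i → decidable-stable (Z? (y j)) λ ¬z → none (j , j≢i , ¬z)))
  ...   | yes (j , j≢i , ¬Zj) with any? (λ l → ¬? (l Fin.≟ i) ×-dec ¬? (l Fin.≟ j) ×-dec ¬? (Z? (y l)))
  ...     | no none = inj₂ (inj₂ (inj₁ (record { i = i ; j = j ; i≢j = j≢i ∘ sym ; ∤i = ¬Zi ; ∤j = ¬Zj
              ; rest = λ l ≢i ≢j → decidable-stable (Z? (y l)) λ ¬z → none (l , ≢i , ≢j , ¬z) })))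
  ...     | yes (l , l≢i , l≢j , ¬Zl) = inj₂ (inj₂ (inj₂ (i , j , l , (j≢i , l≢i , l≢j) , ¬Zi , ¬Zj , ¬Zl)))

  -- Clearing the coefficient at the lone index leaves a sum of vanishing terms, so the dot product
  -- is congruent to d i * y i, a product of two units.
  Lone⇒¬Z-dot : Lone p y → ∀ d → (∀ i → ¬ Z (d i)) → ¬ Z (dot d y)
  Lone⇒¬Z-dot (i , ¬Zi , rest) d ¬d zero-sum = ¬Z-* (¬d i) ¬Zi
    (∣-comb₂ 1ℤ -1ℤ zero-sum (∣-dot (d [ i ]≔ 0ℤ) y vanish)
      (trans (lemma (dot d y) (d i) (y i)) (cong (λ s → 1ℤ * dot d y + -1ℤ * s) (sym (dot-update d y i 0ℤ)))))
    where
    lemma : ∀ s d y → d * y ≡ 1ℤ * s + -1ℤ * (s + (0ℤ - d) * y)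
    lemma = solve-∀
    vanish : ∀ j → Z ((d [ i ]≔ 0ℤ) j) ⊎ Z (y j)
    vanish j with j Fin.≟ i
    ... | yes refl = inj₁ (subst Z (sym (update-same d i 0ℤ)) Z-0)
    ... | no j≢i   = inj₂ (rest j j≢i)

  module _ (7≤p : 7 ≤ p) where
    open LargePrime 7≤p

    leg : ℤ → ℤ
    leg a = legendre a p

    IsSign-legendre : ∀ {a} → ¬ Z a → IsSign (leg a)
    IsSign-legendre {a} ¬a = by-cases (quadraticResidue? a p)
      where
      by-cases : Dec (QuadraticResidue a p) → IsSign (leg a)
      by-cases (yes q) = inj₁ (legendre-residue ¬a q)
      by-cases (no ¬q) = inj₂ (legendre-nonresidue ¬a ¬q)

    IsSign-legendre⇒¬Z : ∀ {a} → IsSign (leg a) → ¬ Z a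
    IsSign-legendre⇒¬Z s za with subst IsSign (legendre-zero za) s
    ... | inj₁ ()
    ... | inj₂ ()

    legendre-surjective : ∀ {s} → IsSign s → ∃[ a ] leg a ≡ s
    legendre-surjective (inj₁ refl) = 1ℤ , legendre-residue ¬Z-1 (toQuadraticResidue 1ℤ Z-0)
    legendre-surjective (inj₂ refl) with nonresidue
    -- A nonresidue is nonzero modulo p, because 0 is its own square.
    ... | ν , ¬q = ν , legendre-nonresidue (λ z → ¬q (toQuadraticResidue 0ℤ (∣-comb₁ -1ℤ z (lemma ν)))) ¬q
      where
      lemma : ∀ ν → 0ℤ * 0ℤ - ν ≡ -1ℤ * ν
      lemma = solve-∀

    flexible : (∀ (ε : Vector ℤ k) → (∀ i → IsSign (ε i)) → ∃[ d ] (∀ i → leg (d i) ≡ ε i) × Z (dot d y)) → Flexible p y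
    flexible f ε sε with f ε sε
    ... | d , leg-d , zero-sum = d , leg-d , (λ i → subst IsSign (sym (leg-d i)) (sε i)) , zero-sum

    None⇒Flexible : (∀ i → Z (y i)) → Flexible p y
    None⇒Flexible z = flexible λ ε sε → (λ i → proj₁ (legendre-surjective (sε i))) ,
      (λ i → proj₂ (legendre-surjective (sε i))) , ∣-dot (λ i → proj₁ (legendre-surjective (sε i))) y (λ i → inj₂ (z i))

    -- Start from any coefficients with the prescribed characters. Scaling three of them by nonzero
    -- squares keeps the characters, and the ternary form can be made to cancel the sum of all other
    -- terms.
    Three⇒Flexible : Three → Flexible p y
    Three⇒Flexible (i , j , l , (j≢i , l≢i , l≢j) , ¬Zi , ¬Zj , ¬Zl) = flexible solution
      where
      solution : ∀ (ε : Vector ℤ k) → (∀ i → IsSign (ε i)) → ∃[ d ] (∀ i → leg (d i) ≡ ε i) × Z (dot d y)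
      solution ε sε = from-form (ternary-form-units {d i * y i} {d j * y j} {d l * y l}
          (¬Z-* (¬Zd i) ¬Zi) (¬Z-* (¬Zd j) ¬Zj) (¬Z-* (¬Zd l) ¬Zl)
          (d i * y i + d j * y j + d l * y l - dot d y))
        where
        d : Vector ℤ k
        d m = proj₁ (legendre-surjective (sε m))
        leg-d : ∀ m → leg (d m) ≡ ε m
        leg-d m = proj₂ (legendre-surjective (sε m))
        ¬Zd : ∀ m → ¬ Z (d m)
        ¬Zd m = IsSign-legendre⇒¬Z (subst IsSign (sym (leg-d m)) (sε m))
        scale : Vector ℤ k → Fin k → ℤ → Vector ℤ k
        scale e m x = e [ m ]≔ (d m * (x * x))
        leg-scale : ∀ e m {x} → ¬ Z x → (∀ i → leg (e i) ≡ ε i) → ∀ i → leg (scale e m x i) ≡ ε i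
        leg-scale e m {x} ¬x leg-e i with i Fin.≟ m
        ... | yes refl = trans (cong leg (update-same e m _)) (trans (legendre-*-square (d m) ¬x) (leg-d m))
        ... | no i≢m   = trans (cong leg (update-other e _ i≢m)) (leg-e i)
        lemma : ∀ s a u b v c w X Y Z →
          s + (a * X - a) * u + (b * Y - b) * v + (c * Z - c) * w ≡
          a * u * X + b * v * Y + c * w * Z - (a * u + b * v + c * w - s)
        lemma = solve-∀
        from-form : (∃[ x ] ∃[ y′ ] ∃[ z ] ¬ Z x × ¬ Z y′ × ¬ Z z ×
            Z (d i * y i * (x * x) + d j * y j * (y′ * y′) + d l * y l * (z * z)
              - (d i * y i + d j * y j + d l * y l - dot d y))) →
          ∃[ d ] (∀ i → leg (d i) ≡ ε i) × Z (dot d y)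
        from-form (x , y′ , z , ¬x , ¬y′ , ¬z , on) = d₃ ,
          leg-scale d₂ l ¬z (leg-scale d₁ j ¬y′ (leg-scale d i ¬x leg-d)) ,
          subst Z (sym dot-d₃) on
          where
          d₁ = scale d i x
          d₂ = scale d₁ j y′
          d₃ = scale d₂ l z
          open ≡-Reasoning
          dot-d₃ : dot d₃ y ≡ d i * y i * (x * x) + d j * y j * (y′ * y′) + d l * y l * (z * z)
                     - (d i * y i + d j * y j + d l * y l - dot d y)
          dot-d₃ = begin
            dot d₃ y
              ≡⟨ dot-update d₂ y l (d l * (z * z)) ⟩
            dot d₂ y + (d l * (z * z) - d₂ l) * y l
              ≡⟨ cong₂ (λ s t → s + (d l * (z * z) - t) * y l) (dot-update d₁ y j (d j * (y′ * y′)))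
                   (trans (update-other d₁ _ l≢j) (update-other d _ l≢i)) ⟩
            dot d₁ y + (d j * (y′ * y′) - d₁ j) * y j + (d l * (z * z) - d l) * y l
              ≡⟨ cong₂ (λ s t → s + (d j * (y′ * y′) - t) * y j + (d l * (z * z) - d l) * y l)
                   (dot-update d y i (d i * (x * x))) (update-other d _ j≢i) ⟩
            dot d y + (d i * (x * x) - d i) * y i + (d j * (y′ * y′) - d j) * y j + (d l * (z * z) - d l) * y l
              ≡⟨ lemma (dot d y) (d i) (y i) (d j) (y j) (d l) (y l) (x * x) (y′ * y′) (z * z) ⟩
            d i * y i * (x * x) + d j * y j * (y′ * y′) + d l * y l * (z * z)
              - (d i * y i + d j * y j + d l * y l - dot d y) ∎

    -- With all other coefficients fixed, the zero-sum condition is solved for the one at j. The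
    -- solution is a unit, since y j times it is congruent to -(d i * y i).
    Pair⇒FlexibleExcept : (t : Pair p y) → FlexibleExcept p y (Pair.j t)
    Pair⇒FlexibleExcept t ε sε = from-quotient (Z-divide ∤j (d j * y j - dot d y))
      where
      open Pair t
      d : Vector ℤ k
      d m = proj₁ (legendre-surjective (sε m))
      leg-d : ∀ m → leg (d m) ≡ ε m
      leg-d m = proj₂ (legendre-surjective (sε m))
      ¬Zd : ∀ m → ¬ Z (d m)
      ¬Zd m = IsSign-legendre⇒¬Z (subst IsSign (sym (leg-d m)) (sε m))
      -- With both entries of the pair cleared, only terms divisible by p remain.
      d₀ = (d [ j ]≔ 0ℤ) [ i ]≔ 0ℤ
      vanish : ∀ l → Z (d₀ l) ⊎ Z (y l)
      vanish l with l Fin.≟ i | l Fin.≟ j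
      ... | yes refl | _        = inj₁ (subst Z (sym (update-same (d [ j ]≔ 0ℤ) i 0ℤ)) Z-0)
      ... | no ≢i    | yes refl = inj₁ (subst Z
          (sym (trans (update-other (d [ j ]≔ 0ℤ) 0ℤ ≢i) (update-same d j 0ℤ))) Z-0)
      ... | no ≢i    | no ≢j    = inj₂ (rest l ≢i ≢j)
      dot-d₀ : dot d₀ y ≡ dot d y + (0ℤ - d j) * y j + (0ℤ - d i) * y i
      dot-d₀ = trans (dot-update (d [ j ]≔ 0ℤ) y i 0ℤ)
        (cong₂ (λ s t → s + (0ℤ - t) * y i) (dot-update d y j 0ℤ) (update-other d 0ℤ i≢j))
      ¬Z-rest : ¬ Z (d j * y j - dot d y)
      ¬Z-rest z = ¬Z-* (¬Zd i) ∤i (∣-comb₂ {a = dot d₀ y} -1ℤ -1ℤ (∣-dot d₀ y vanish) z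
        (trans (lemma (dot d y) (d i) (y i) (d j) (y j))
               (cong (λ s → -1ℤ * s + -1ℤ * (d j * y j - dot d y)) (sym dot-d₀))))
        where
        lemma : ∀ s a u b v → a * u ≡ -1ℤ * (s + (0ℤ - b) * v + (0ℤ - a) * u) + -1ℤ * (b * v - s)
        lemma = solve-∀
      from-quotient : (∃[ x ] Z (y j * x - (d j * y j - dot d y))) →
        ∃[ d ] (∀ i → i ≢ j → leg (d i) ≡ ε i) × Solves p y d
      from-quotient (x , zx) = d [ j ]≔ x , leg-d′ , sign , subst Z
          (sym (trans (dot-update d y j x) (lemma (dot d y) x (d j) (y j)))) zx
        where
        lemma : ∀ s x d y → s + (x - d) * y ≡ y * x - (d * y - s)
        lemma = solve-∀
        leg-d′ : ∀ i → i ≢ j → leg ((d [ j ]≔ x) i) ≡ ε i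
        leg-d′ i i≢j = trans (cong leg (update-other d x i≢j)) (leg-d i)
        sign : ∀ i → IsSign (leg ((d [ j ]≔ x) i))
        sign i with i Fin.≟ j
        ... | yes refl = subst (IsSign ∘ leg) (sym (update-same d j x))
            (IsSign-legendre (¬Z-factorʳ {y j} {x} ¬Z-rest zx))
        ... | no i≢j   = subst IsSign (sym (leg-d′ i i≢j)) (sε i)

-- Zero-sums modulo several primes

-- Shaped so that `jacobi a n` unfolds to `prod (legendre a)` over the prime factors of n.
prod : (ℕ → ℤ) → List ℕ → ℤ
prod f ps = foldr _*_ 1ℤ (map f ps)

prod-cong : ∀ {f g ps} → All (λ p → f p ≡ g p) ps → prod f ps ≡ prod g ps
prod-cong []         = refl
prod-cong (eq ∷ eqs) = cong₂ _*_ eq (prod-cong eqs)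

prod-IsSign : ∀ {f ps} → All (λ p → IsSign (f p)) ps → IsSign (prod f ps)
prod-IsSign []       = inj₁ refl
prod-IsSign (s ∷ ss) = IsSign-* s (prod-IsSign ss)

-- The ratio of the products is f q / g q, here cleared of denominators; uniqueness makes q
-- contribute a single factor.
prod-replace : ∀ {f g q ps} → Unique ps → q ∈ ps → (∀ p → p ≢ q → f p ≡ g p) →
  prod f ps * g q ≡ prod g ps * f q
prod-replace {f} {g} {q} {_ ∷ ps} (q∉ ∷ _) (here refl) f≗g = trans
  (cong (λ t → f q * t * g q) (prod-cong (All.map (λ q≢p → f≗g _ (q≢p ∘ sym)) q∉)))
  (lemma (f q) (prod g ps) (g q))
  where
  lemma : ∀ a b c → a * b * c ≡ c * b * a
  lemma = solve-∀
prod-replace {f} {g} {q} {p ∷ ps} (p∉ ∷ unique) (there q∈) f≗g = begin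
  f p * prod f ps * g q    ≡⟨ ℤ.*-assoc (f p) _ _ ⟩
  f p * (prod f ps * g q)  ≡⟨ cong₂ _*_ (f≗g p (All.lookup p∉ q∈)) (prod-replace unique q∈ f≗g) ⟩
  g p * (prod g ps * f q)  ≡⟨ ℤ.*-assoc (g p) _ _ ⟨
  g p * prod g ps * f q    ∎
  where open ≡-Reasoning

-- Coefficient families are functions of the prime, so witnesses stored along the list are turned
-- into one function; outside the list it takes the default value.
choose : ∀ {X : Set} {P : ℕ → X → Set} {ps} → X → All (λ p → ∃[ x ] P p x) ps →
  ∃[ f ] All (λ p → P p (f p)) ps
choose {X} {P} default pxs = select pxs , All.tabulate (select-correct pxs)
  where
  select : ∀ {ps} → All (λ p → ∃[ x ] P p x) ps → ℕ → X
  select [] _ = default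
  select {q ∷ _} (px ∷ pxs) p with p ℕ.≟ q
  ... | yes _ = proj₁ px
  ... | no _  = select pxs p
  select-correct : ∀ {ps} (pxs : All (λ p → ∃[ x ] P p x) ps) {p} → p ∈ ps → P p (select pxs p)
  select-correct {q ∷ _} (px ∷ pxs) {p} p∈ with p ℕ.≟ q
  ... | yes refl = proj₂ px
  select-correct (px ∷ pxs) (here p≡q) | no p≢q = contradiction p≡q p≢q
  select-correct (px ∷ pxs) (there p∈) | no _   = select-correct pxs p∈

All-⊎ : ∀ {P Q : ℕ → Set} {ps} → All (λ p → P p ⊎ Q p) ps → Any P ps ⊎ All Q ps
All-⊎ [] = inj₂ []
All-⊎ (inj₁ x ∷ _) = inj₁ (here x)
All-⊎ (inj₂ y ∷ xs) with All-⊎ xs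
... | inj₁ any = inj₁ (there any)
... | inj₂ all = inj₂ (y ∷ all)

module Family {k : ℕ} (y : Vector ℤ k) {ps : List ℕ} (unique : Unique ps) where

  Solution : (ℕ → Vector ℤ k) → Set
  Solution c = All (λ p → Solves p y (c p)) ps

  -- The Jacobi symbol of the i-th coefficient, which is c p i modulo p.
  symbol : (ℕ → Vector ℤ k) → Fin k → ℤ
  symbol c i = prod (λ p → legendre (c p i) p) ps

  Balanced : Set
  Balanced = ∃[ c ] Solution c × (∀ i → symbol c i ≡ 1ℤ)

  replace : (ℕ → Vector ℤ k) → ℕ → Vector ℤ k → ℕ → Vector ℤ k
  replace c q d p with p ℕ.≟ q
  ... | yes _ = d
  ... | no _  = c p

  replace-same : ∀ c q d → replace c q d q ≡ d
  replace-same c q d with q ℕ.≟ q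
  ... | yes _  = refl
  ... | no q≢q = contradiction refl q≢q

  replace-other : ∀ c q d p → p ≢ q → replace c q d p ≡ c p
  replace-other c q d p p≢q with p ℕ.≟ q
  ... | yes p≡q = contradiction p≡q p≢q
  ... | no _    = refl

  replace-solution : ∀ {c q d} → Solution c → Solves q y d → Solution (replace c q d)
  replace-solution {c} {q} {d} sol solves = All.map step sol
    where
    step : ∀ {p} → Solves p y (c p) → Solves p y (replace c q d p)
    step {p} s with p ℕ.≟ q
    ... | yes refl = solves
    ... | no _     = s

  symbol-replace : ∀ c {q} d i → q ∈ ps →
    symbol (replace c q d) i * legendre (c q i) q ≡ symbol c i * legendre (d i) q
  symbol-replace c {q} d i q∈ = trans
    (prod-replace {λ p → legendre (replace c q d p i) p} {λ p → legendre (c p i) p} unique q∈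
      (λ p p≢q → cong (λ e → legendre (e i) p) (replace-other c q d p p≢q)))
    (cong (λ e → symbol c i * legendre (e i) q) (replace-same c q d))

  IsSign-at : ∀ {c} → Solution c → ∀ {q} → q ∈ ps → ∀ i → IsSign (legendre (c q i) q)
  IsSign-at sol q∈ = proj₁ (All.lookup sol q∈)

  IsSign-symbol : ∀ {c} → Solution c → ∀ i → IsSign (symbol c i)
  IsSign-symbol sol i = prod-IsSign (All.map (λ s → proj₁ s i) sol)

  symbol-keep : ∀ {c} → Solution c → ∀ {q} → q ∈ ps → ∀ d i → legendre (d i) q ≡ legendre (c q i) q →
    symbol (replace c q d) i ≡ symbol c i
  symbol-keep {c} sol {q} q∈ d i eq = IsSign-*-cancelʳ (IsSign-at sol q∈ i)
    (trans (symbol-replace c d i q∈) (cong (symbol c i *_) eq))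

  -- Signs are their own inverses, so this is the product of the symbols at the primes other than q:
  -- the value wanted at q for a total of 1.
  correction : (ℕ → Vector ℤ k) → ℕ → Vector ℤ k
  correction c q i = symbol c i * legendre (c q i) q

  IsSign-correction : ∀ {c} → Solution c → ∀ {q} → q ∈ ps → ∀ i → IsSign (correction c q i)
  IsSign-correction sol q∈ i = IsSign-* (IsSign-symbol sol i) (IsSign-at sol q∈ i)

  symbol-correct : ∀ {c} → Solution c → ∀ {q} → q ∈ ps → ∀ d i → legendre (d i) q ≡ correction c q i →
    symbol (replace c q d) i ≡ 1ℤ
  symbol-correct {c} sol {q} q∈ d i eq = IsSign-*-cancelʳ (IsSign-at sol q∈ i) (begin
    symbol (replace c q d) i * legendre (c q i) q       ≡⟨ symbol-replace c d i q∈ ⟩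
    symbol c i * legendre (d i) q                       ≡⟨ cong (symbol c i *_) eq ⟩
    symbol c i * (symbol c i * legendre (c q i) q)      ≡⟨ ℤ.*-assoc (symbol c i) (symbol c i) _ ⟨
    symbol c i * symbol c i * legendre (c q i) q        ≡⟨ cong (_* legendre (c q i) q) (square (IsSign-symbol sol i)) ⟩
    1ℤ * legendre (c q i) q                             ∎)
    where
    open ≡-Reasoning
    square : ∀ {s} → IsSign s → s * s ≡ 1ℤ
    square (inj₁ refl) = refl
    square (inj₂ refl) = refl

  -- One flexible prime can supply the corrections for all indices at once.
  Flexible⇒Balanced : ∀ {c q} → Solution c → q ∈ ps → Flexible q y → Balanced
  Flexible⇒Balanced {c} {q} sol q∈ flex with flex (correction c q) (IsSign-correction sol q∈)
  ... | d , leg-d , solves = replace c q d , replace-solution sol solves , λ i → symbol-correct sol q∈ d i (leg-d i)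

  -- A coefficient at an index j with q ∣ y j may be changed modulo q at will.
  FlexibleExcept⇒Balanced : ∀ {c p q j} → Solution c → p ∈ ps → q ∈ ps → (pr : Prime q) → 7 ≤ q →
    FlexibleExcept p y j → + q ∣ᶻ y j → Balanced
  FlexibleExcept⇒Balanced {c} {p} {q} {j} sol p∈ q∈ pr 7≤q flex q∣yⱼ
    with flex (correction c p) (IsSign-correction sol p∈)
  ... | d , leg-d , solves = second-step
    (Support.legendre-surjective pr y 7≤q (IsSign-correction sol₁ q∈ j))
    where
    c₁ = replace c p d
    sol₁ : Solution c₁
    sol₁ = replace-solution sol solves
    second-step : (∃[ a ] legendre a q ≡ correction c₁ q j) → Balanced
    -- The replacement at p has corrected every index other than j. The replacement at q alters the
    -- entry j alone, and keeps the zero-sum since q divides y j.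
    second-step (a , leg-a) = replace c₁ q e , replace-solution sol₁ (sign , zero-sum) , symbol-1
      where
      e = c₁ q [ j ]≔ a
      leg-e-j : legendre (e j) q ≡ correction c₁ q j
      leg-e-j = trans (cong (λ t → legendre t q) (update-same (c₁ q) j a)) leg-a
      leg-e : ∀ i → i ≢ j → legendre (e i) q ≡ legendre (c₁ q i) q
      leg-e i i≢j = cong (λ t → legendre t q) (update-other (c₁ q) a i≢j)
      sign : ∀ i → IsSign (legendre (e i) q)
      sign i with i Fin.≟ j
      ... | yes refl = subst IsSign (sym leg-e-j) (IsSign-correction sol₁ q∈ j)
      ... | no i≢j   = subst IsSign (sym (leg-e i i≢j)) (IsSign-at sol₁ q∈ i)
      zero-sum : + q ∣ᶻ dot e y
      zero-sum = subst (+ q ∣ᶻ_) (sym (dot-update (c₁ q) y j a))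
        (∣m∣n⇒∣m+n (proj₂ (All.lookup sol₁ q∈)) (∣n⇒∣m*n (a - c₁ q j) q∣yⱼ))
      symbol-1 : ∀ i → symbol (replace c₁ q e) i ≡ 1ℤ
      symbol-1 i with i Fin.≟ j
      ... | yes refl = symbol-correct sol₁ q∈ e j leg-e-j
      ... | no i≢j   = trans (symbol-keep sol₁ q∈ e i (leg-e i i≢j)) (symbol-correct sol p∈ d i (leg-d i i≢j))

  module _ (large : All (λ p → Prime p × 7 ≤ p) ps) (¬lone : All (λ p → ¬ Lone p y) ps) where

    private
      classify : ∀ {p} → Prime p × 7 ≤ p → ¬ Lone p y → Flexible p y ⊎ Pair p y
      classify {p} (pr , 7≤p) ¬l = by-support (Support.support pr y)
        where
        by-support : (∀ i → + p ∣ᶻ y i) ⊎ Lone p y ⊎ Pair p y ⊎ Support.Three pr y → Flexible p y ⊎ Pair p y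
        by-support (inj₁ none)                 = inj₁ (Support.None⇒Flexible pr y 7≤p none)
        by-support (inj₂ (inj₁ lone))          = contradiction lone ¬l
        by-support (inj₂ (inj₂ (inj₁ pair)))   = inj₂ pair
        by-support (inj₂ (inj₂ (inj₂ three)))  = inj₁ (Support.Three⇒Flexible pr y 7≤p three)

      classification : All (λ p → Flexible p y ⊎ Pair p y) ps
      classification = All.zipWith (λ (l , ¬l) → classify l ¬l) (large , ¬lone)

      solve-one : ∀ {p} → Prime p × 7 ≤ p → Flexible p y ⊎ Pair p y → ∃[ d ] Solves p y d
      solve-one _ (inj₁ flex) =
        -- The signs prescribed here are arbitrary, as this solution is only a starting point for
        -- the corrections.
        let d , _ , solves = flex (const 1ℤ) (const (inj₁ refl)) in d , solves
      solve-one (pr , 7≤p) (inj₂ pair) =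
        let d , _ , solves = Support.Pair⇒FlexibleExcept pr y 7≤p pair (const 1ℤ) (const (inj₁ refl)) in d , solves

      some-solution : ∃[ c ] Solution c
      some-solution = choose (const 1ℤ) (All.zipWith (λ (l , cl) → solve-one l cl) (large , classification))

      Flexible-at⇒Balanced : ∀ {p} → p ∈ ps → Flexible p y → Balanced
      Flexible-at⇒Balanced = Flexible⇒Balanced (proj₂ some-solution)

      Pair⇒Balanced : ∀ {p q} → p ∈ ps → q ∈ ps → (pair : Pair p y) → + q ∣ᶻ y (Pair.j pair) → Balanced
      Pair⇒Balanced p∈ q∈ pair q∣ = FlexibleExcept⇒Balanced (proj₂ some-solution) p∈ q∈
        (proj₁ (All.lookup large q∈)) (proj₂ (All.lookup large q∈))
        (Support.Pair⇒FlexibleExcept (proj₁ (All.lookup large p∈)) y (proj₂ (All.lookup large p∈)) pair) q∣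

    None⇒Balanced : Any (λ p → ∀ i → + p ∣ᶻ y i) ps → Balanced
    None⇒Balanced any = from-prime (find any)
      where
      from-prime : (∃[ p ] p ∈ ps × (∀ i → + p ∣ᶻ y i)) → Balanced
      from-prime (p , p∈ , none) = Flexible-at⇒Balanced p∈
        (Support.None⇒Flexible (proj₁ (All.lookup large p∈)) y (proj₂ (All.lookup large p∈)) none)

    -- Suppose all primes have exactly two nonzero terms, those of p being at i and j. A third index
    -- l has a prime q not dividing y l. The support of q then misses i or j, and the missed index
    -- can be taken as the exceptional one of p.
    nonzero⇒Balanced : 3 ≤ k → (∀ i → Any (λ p → ¬ (+ p ∣ᶻ y i)) ps) → Balanced
    nonzero⇒Balanced 3≤k nonzero = by-classification (All-⊎ classification)
      where
      by-third : ∀ {p q} (pair : Pair p y) → p ∈ ps → q ∈ ps → Pair q y →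
        ∀ l → l ≢ Pair.i pair → l ≢ Pair.j pair → ¬ (+ q ∣ᶻ y l) → Balanced
      by-third {q = q} pair p∈ q∈ pair′ l l≢i l≢j ∤l = decide (+ q ∣? y P.i) (+ q ∣? y P.j)
        where
        module P = Pair pair
        module Q = Pair pair′
        decide : Dec (+ q ∣ᶻ y P.i) → Dec (+ q ∣ᶻ y P.j) → Balanced
        -- A pair is symmetric, so either of its indices can play the exceptional role.
        decide (yes q∣i) _         = Pair⇒Balanced p∈ q∈ P.swap q∣i
        decide (no _)    (yes q∣j) = Pair⇒Balanced p∈ q∈ pair q∣j
        decide (no ∤i)   (no ∤j)   = ⊥-elim (no-three-in-two P.i≢j (l≢i ∘ sym) (l≢j ∘ sym)
          (Q.∤⇒∈ P.i ∤i) (Q.∤⇒∈ P.j ∤j) (Q.∤⇒∈ l ∤l))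

      by-pairs : All (λ p → Pair p y) ps →
        (∃[ p ] p ∈ ps × ¬ (+ p ∣ᶻ y (Fin.fromℕ< (ℕ.≤-trans (s≤s z≤n) 3≤k)))) → Balanced
      by-pairs pairs (p , p∈ , _) = by-index (third-index 3≤k (Pair.i pair) (Pair.j pair))
        where
        pair = All.lookup pairs p∈
        by-prime : ∀ l → l ≢ Pair.i pair → l ≢ Pair.j pair → (∃[ q ] q ∈ ps × ¬ (+ q ∣ᶻ y l)) → Balanced
        by-prime l l≢i l≢j (q , q∈ , ∤l) = by-third pair p∈ q∈ (All.lookup pairs q∈) l l≢i l≢j ∤l
        by-index : (∃[ l ] l ≢ Pair.i pair × l ≢ Pair.j pair) → Balanced
        by-index (l , l≢i , l≢j) = by-prime l l≢i l≢j (find (nonzero l))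

      by-flexible : (∃[ p ] p ∈ ps × Flexible p y) → Balanced
      by-flexible (p , p∈ , flex) = Flexible-at⇒Balanced p∈ flex

      by-classification : Any (λ p → Flexible p y) ps ⊎ All (λ p → Pair p y) ps → Balanced
      by-classification (inj₁ any)   = by-flexible (find any)
      -- A nonzero term yields a prime of the list whose pair starts the comparison.
      by-classification (inj₂ pairs) = by-pairs pairs (find (nonzero _))

-- Chinese remainder theorem

∣-product⇒∈ : ∀ {p ps} → Prime p → All Prime ps → + p ∣ᶻ + product ps → p ∈ ps
∣-product⇒∈ pr prs d = factorisationHasAllPrimeFactors pr (∣⇒∣ᵤ d) prs

∉⇒∤-product : ∀ {p ps} → Prime p → All Prime ps → All (p ≢_) ps → ¬ (+ p ∣ᶻ + product ps)
∉⇒∤-product pr prs p∉ d = All.lookup p∉ (∣-product⇒∈ pr prs d) refl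

-- Write x = q N with N the product of the remaining primes. The prime p does not divide N, so it
-- divides q.
product-∣ : ∀ {ps} → All Prime ps → Unique ps → ∀ {x} → All (λ p → + p ∣ᶻ x) ps → + product ps ∣ᶻ x
product-∣ []         _             {x} _         = divides x (sym (ℤ.*-identityʳ x))
product-∣ {p ∷ ps} (pr ∷ prs) (p∉ ∷ unique) {x} (p∣ ∷ ps∣) = combine (product-∣ prs unique ps∣)
  where
  lemma : ∀ {x} q r p N → x ≡ q * N → q ≡ r * p → x ≡ r * (p * N)
  lemma q r p N refl refl = ℤ.*-assoc r p N
  combine : + product ps ∣ᶻ x → + (p ℕ.* product ps) ∣ᶻ x
  combine (divides q eq) with ModPrime.Z-euclid pr q (+ product ps) (subst (+ p ∣ᶻ_) eq p∣)
  ... | inj₂ p∣N = contradiction p∣N (∉⇒∤-product pr prs p∉)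
  ... | inj₁ (divides r eq′) = divides r (trans (lemma q r (+ p) (+ product ps) eq eq′)
          (cong (r *_) (sym (ℤ.pos-* p (product ps)))))

∈⇒∣ᶻproduct : ∀ {p ps} → p ∈ ps → + p ∣ᶻ + product ps
∈⇒∣ᶻproduct p∈ = ∣ᵤ⇒∣ (∈⇒∣product p∈)

-- By induction: adding a multiple of the product N of the other primes keeps their congruences, and
-- N is invertible modulo p, so the congruence modulo p can be met.
chinese-remainder : ∀ {ps} → All Prime ps → Unique ps → (f : ℕ → ℤ) → ∃[ x ] All (λ p → + p ∣ᶻ x - f p) ps
chinese-remainder [] _ f = 0ℤ , []
chinese-remainder {p ∷ ps} (pr ∷ prs) (p∉ ∷ unique) f = extend (chinese-remainder prs unique f)
  where
  N = + product ps
  lemma₁ : ∀ x N t a → x + N * t - a ≡ 1ℤ * (N * t - (a - x))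
  lemma₁ = solve-∀
  lemma₂ : ∀ x N t a → x + N * t - a ≡ 1ℤ * (x - a) + t * N
  lemma₂ = solve-∀
  extend : (∃[ x ] All (λ q → + q ∣ᶻ x - f q) ps) → ∃[ x ] All (λ q → + q ∣ᶻ x - f q) (p ∷ ps)
  extend (x , ps∣) = lift (ModPrime.Z-divide pr (∉⇒∤-product pr prs p∉) (f p - x))
    where
    lift : (∃[ t ] + p ∣ᶻ N * t - (f p - x)) → ∃[ x ] All (λ q → + q ∣ᶻ x - f q) (p ∷ ps)
    lift (t , p∣) = x + N * t , ∣-comb₁ 1ℤ p∣ (lemma₁ x N t (f p)) ∷
      All.tabulate (λ {q} q∈ → ∣-comb₂ {b = N} 1ℤ t (All.lookup ps∣ q∈) (∈⇒∣ᶻproduct q∈) (lemma₂ x N t (f q)))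

-- A repeated prime would have its square dividing the product.
squarefree⇒Unique : ∀ {ps} → All Prime ps → Squarefree (product ps) → Unique ps
squarefree⇒Unique [] _ = []
squarefree⇒Unique {p ∷ ps} (pr ∷ prs) sf =
  All.tabulate (λ q∈ → λ { refl → ¬prime[1] (subst Prime (sf p (ℕ∣.*-monoʳ-∣ p (∈⇒∣product q∈))) pr) })
  ∷ squarefree⇒Unique prs (λ d d²∣ → sf d (ℕ∣.∣n⇒∣m*n p d²∣))

∣-dot-cong : ∀ {m k} (a c y : Vector ℤ k) → (∀ i → m ∣ᶻ a i - c i) → m ∣ᶻ dot c y → m ∣ᶻ dot a y
∣-dot-cong {m} {k} a c y a≈c m∣ = ∣-comb₂ 1ℤ 1ℤ (difference a c y a≈c) m∣ (lemma (dot a y) (dot c y))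
  where
  lemma : ∀ s t → s ≡ 1ℤ * (s - t) + 1ℤ * t
  lemma = solve-∀
  step : ∀ a c y s t → a * y + s - (c * y + t) ≡ y * (a - c) + 1ℤ * (s - t)
  step = solve-∀
  difference : ∀ {k} (a c y : Vector ℤ k) → (∀ i → m ∣ᶻ a i - c i) → m ∣ᶻ dot a y - dot c y
  difference {zero}  a c y a≈c = divides 0ℤ refl
  difference {suc k} a c y a≈c = ∣-comb₂ (y zero) 1ℤ (a≈c zero) (difference (a ∘ suc) (c ∘ suc) (y ∘ suc) (a≈c ∘ suc))
    (step (a zero) (c zero) (y zero) (dot (a ∘ suc) (y ∘ suc)) (dot (c ∘ suc) (y ∘ suc)))

-- Lists with a single exception to a predicate

module _ {A : Set} (Z : Pred A 0ℓ) where

  -- List counterpart of `Lone`. The inductive form suits splitting and passing to consecutive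
  -- blocks; `lookup⇒LoneExcept` and `LoneExcept⇒lookup` convert between it and the form by indices.
  data LoneExcept : List A → Set where
    here  : ∀ {x xs} → ¬ Z x → All Z xs → LoneExcept (x ∷ xs)
    there : ∀ {x xs} → Z x → LoneExcept xs → LoneExcept (x ∷ xs)

module _ {A : Set} {Z : Pred A 0ℓ} where

  loneExcept? : Decidable Z → Decidable (LoneExcept Z)
  loneExcept? Z? [] = no λ ()
  loneExcept? Z? (x ∷ xs) with Z? x
  loneExcept? Z? (x ∷ xs) | yes z with loneExcept? Z? xs
  ... | yes l = yes (there z l)
  ... | no ¬l = no λ { (here ¬z _) → ¬z z ; (there _ l) → ¬l l }
  loneExcept? Z? (x ∷ xs) | no ¬z with All.all? Z? xs
  ... | yes zs = yes (here ¬z zs)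
  ... | no ¬zs = no λ { (here _ zs) → ¬zs zs ; (there z _) → ¬z z }

  LoneExcept⇒¬All : ∀ {xs} → LoneExcept Z xs → ¬ All Z xs
  LoneExcept⇒¬All (here ¬z _)  (z ∷ _)  = ¬z z
  LoneExcept⇒¬All (there _ l) (_ ∷ zs) = LoneExcept⇒¬All l zs

  LoneExcept-split : ∀ {xs} → LoneExcept Z xs → ∃[ ls ] ∃[ x ] ∃[ rs ] xs ≡ ls ++ x ∷ rs × All Z ls × All Z rs
  LoneExcept-split (here {x} {xs} _ zs) = [] , x , xs , refl , [] , zs
  LoneExcept-split (there {x} z l) with LoneExcept-split l
  ... | ls , m , rs , refl , zl , zr = x ∷ ls , m , rs , refl , z ∷ zl , zr

  LoneExcept-++ : ∀ {ls x rs} → All Z ls → ¬ Z x → All Z rs → LoneExcept Z (ls ++ x ∷ rs)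
  LoneExcept-++ []       ¬z zr = here ¬z zr
  LoneExcept-++ (z ∷ zl) ¬z zr = there z (LoneExcept-++ zl ¬z zr)

  All-prefix : ∀ {ys xs} → Prefix _≡_ ys xs → All Z xs → All Z ys
  All-prefix []            _        = []
  All-prefix (refl ∷ pref) (z ∷ zs) = z ∷ All-prefix pref zs

  All-infix : ∀ {ys xs} → Infix _≡_ ys xs → All Z xs → All Z ys
  All-infix (here pref) zs       = All-prefix pref zs
  All-infix (there inf) (_ ∷ zs) = All-infix inf zs

  LoneExcept-prefix : ∀ {ys xs} → Prefix _≡_ ys xs → LoneExcept Z xs → LoneExcept Z ys ⊎ All Z ys
  LoneExcept-prefix []            _            = inj₂ []
  LoneExcept-prefix (refl ∷ pref) (here ¬z zs) = inj₁ (here ¬z (All-prefix pref zs))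
  LoneExcept-prefix (refl ∷ pref) (there z l) with LoneExcept-prefix pref l
  ... | inj₁ l′ = inj₁ (there z l′)
  ... | inj₂ zs = inj₂ (z ∷ zs)

  LoneExcept-infix : ∀ {ys xs} → Infix _≡_ ys xs → LoneExcept Z xs → LoneExcept Z ys ⊎ All Z ys
  LoneExcept-infix (here pref) l           = LoneExcept-prefix pref l
  LoneExcept-infix (there inf) (here _ zs) = inj₂ (All-infix inf zs)
  LoneExcept-infix (there inf) (there _ l) = LoneExcept-infix inf l

  prefix-avoid : ∀ {ys} ls {x rs} → Prefix _≡_ ys (ls ++ x ∷ rs) → All Z ys → ¬ Z x → Prefix _≡_ ys ls
  prefix-avoid []       []            _        _  = []
  prefix-avoid (_ ∷ ls) []            _        _  = []
  prefix-avoid []       (refl ∷ _)    (z ∷ _)  ¬z = contradiction z ¬z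
  prefix-avoid (_ ∷ ls) (refl ∷ pref) (_ ∷ zs) ¬z = refl ∷ prefix-avoid ls pref zs ¬z

  infix-avoid : ∀ {ys} ls {x rs} → Infix _≡_ ys (ls ++ x ∷ rs) → All Z ys → ¬ Z x →
    Infix _≡_ ys ls ⊎ Infix _≡_ ys rs
  infix-avoid []       (here pref) zs ¬z = inj₁ (here (prefix-avoid [] pref zs ¬z))
  infix-avoid (l ∷ ls) (here pref) zs ¬z = inj₁ (here (prefix-avoid (l ∷ ls) pref zs ¬z))
  infix-avoid []       (there inf) zs ¬z = inj₂ inf
  infix-avoid (_ ∷ ls) (there inf) zs ¬z with infix-avoid ls inf zs ¬z
  ... | inj₁ inf′ = inj₁ (there inf′)
  ... | inj₂ inf′ = inj₂ inf′

  lookup⇒All : ∀ xs → (∀ i → Z (lookup xs i)) → All Z xs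
  lookup⇒All []       _ = []
  lookup⇒All (x ∷ xs) z = z zero ∷ lookup⇒All xs (z ∘ suc)

  All⇒lookup : ∀ {xs} → All Z xs → ∀ i → Z (lookup xs i)
  All⇒lookup zs i = All.lookup zs (∈-lookup i)

  lookup⇒LoneExcept : ∀ xs i → ¬ Z (lookup xs i) → (∀ j → j ≢ i → Z (lookup xs j)) → LoneExcept Z xs
  lookup⇒LoneExcept (x ∷ xs) zero    ¬z rest = here ¬z (lookup⇒All xs (λ j → rest (suc j) λ ()))
  lookup⇒LoneExcept (x ∷ xs) (suc i) ¬z rest =
    there (rest zero λ ()) (lookup⇒LoneExcept xs i ¬z λ j j≢i → rest (suc j) (j≢i ∘ Fin.suc-injective))

  LoneExcept⇒lookup : ∀ {xs} → LoneExcept Z xs → ∃[ i ] ¬ Z (lookup xs i) × (∀ j → j ≢ i → Z (lookup xs j))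
  LoneExcept⇒lookup (here ¬z zs) = zero , ¬z , λ { zero 0≢0 → contradiction refl 0≢0 ; (suc j) _ → All⇒lookup zs j }
  LoneExcept⇒lookup (there z l) with LoneExcept⇒lookup l
  ... | i , ¬z , rest = suc i , ¬z , λ { zero _ → z ; (suc j) j≢i → rest j (j≢i ∘ cong suc) }

-- Consecutive blocks: the halving argument and the extremal sequences

infix-refl : ∀ {A : Set} {xs : List A} → Infix _≡_ xs xs
infix-refl = fromPointwise (Pointwise.refl refl)

infix-lookup : ∀ {A : Set} (xs : List A) i → Infix _≡_ (lookup xs i ∷ []) xs
infix-lookup (x ∷ xs) zero    = here (refl ∷ [])
infix-lookup (x ∷ xs) (suc i) = there (infix-lookup xs i)

length>0⇒≢[] : ∀ {A : Set} {xs : List A} → 1 ≤ length xs → xs ≢ []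
length>0⇒≢[] () refl

2^>0 : ∀ m → 1 ≤ 2 ℕ.^ m
2^>0 m = ℕ.^-monoʳ-≤ 2 (z≤n {m})

-- Here a and b are the lengths on the two sides of a removed term. If both were at most m - 1, the
-- total would be at most 2 m - 1.
half : ∀ m (a b : ℕ) → 2 ℕ.* m ≤ a ℕ.+ suc b → m ≤ a ⊎ m ≤ b
half m a b le with ℕ.≤-<-connex m a
... | inj₁ m≤a = inj₁ m≤a
... | inj₂ a<m = inj₂ (ℕ.+-cancelˡ-≤ m m b (begin
  m ℕ.+ m          ≡⟨ cong (m ℕ.+_) (ℕ.+-identityʳ m) ⟨
  2 ℕ.* m          ≤⟨ le ⟩
  a ℕ.+ suc b      ≡⟨ ℕ.+-suc a b ⟩
  suc a ℕ.+ b      ≤⟨ ℕ.+-monoˡ-≤ b a<m ⟩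
  m ℕ.+ b          ∎))
  where open ℕ.≤-Reasoning

module _ {A : Set} {Z : ℕ → Pred A 0ℓ} (Z? : ∀ p → Decidable (Z p)) where

  -- If p has a single exception, one of the two blocks around it has at least half of the length.
  halving : ∀ m qs → length qs ≡ m → (xs : List A) → 2 ℕ.^ m ≤ length xs →
    ∃[ ys ] Infix _≡_ ys xs × ys ≢ [] × All (λ p → ¬ LoneExcept (Z p) ys) qs ×
      (ys ≡ xs ⊎ Any (λ p → All (Z p) ys) qs)
  halving m qs eq xs le with Any.any? (λ p → loneExcept? (Z? p) xs) qs
  ... | no none = xs , infix-refl , length>0⇒≢[] (ℕ.≤-trans (2^>0 m) le) , All.¬Any⇒All¬ qs none , inj₁ refl
  halving zero    [] _  xs le | yes ()
  halving (suc m) qs eq xs le | yes any with find any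
  ... | p , p∈ , lone with ∈-∃++ p∈ | LoneExcept-split lone
  ...   | us , vs , refl | ls , x , rs , refl , zl , zr =
    by-half (half (2 ℕ.^ m) (length ls) (length rs) (subst (2 ℕ.* 2 ℕ.^ m ≤_) (List.length-++ ls) le))
    where
    Result : List A → Set
    Result zs = ∃[ ys ] Infix _≡_ ys zs × ys ≢ [] × All (λ p → ¬ LoneExcept (Z p) ys) (us ++ p ∷ vs) ×
      Any (λ p → All (Z p) ys) (us ++ p ∷ vs)
    len : length (us ++ vs) ≡ m
    len = ℕ.suc-injective (trans (cong suc (List.length-++ us)) (trans (sym (ℕ.+-suc (length us) (length vs)))
      (trans (sym (List.length-++ us)) eq)))
    recurse : ∀ zs → All (Z p) zs → 2 ℕ.^ m ≤ length zs → Result zs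
    recurse zs z le′ with halving m (us ++ vs) len zs le′
    ... | ys , inf , ys≢[] , ¬lone , _ = ys , inf , ys≢[] ,
      -- The block found lies on one side of the exception, so all its terms vanish at p. Hence p
      -- has no single exception there, and p also witnesses the last alternative.
      All.++⁺ (All.++⁻ˡ us ¬lone) ((λ l → LoneExcept⇒¬All l (All-infix inf z)) ∷ All.++⁻ʳ us ¬lone) ,
      lose p∈ (All-infix inf z)
    by-half : 2 ℕ.^ m ≤ length ls ⊎ 2 ℕ.^ m ≤ length rs → _
    by-half (inj₁ le′) with recurse ls zl le′
    ... | ys , inf , ys≢[] , ¬lone , any = ys , inf ⁱ++ (x ∷ rs) , ys≢[] , ¬lone , inj₂ any
    by-half (inj₂ le′) with recurse rs zr le′
    ... | ys , inf , ys≢[] , ¬lone , any = ys , ls ++ⁱ there inf , ys≢[] , ¬lone , inj₂ any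

  module _ (e : ℕ → A) where

    -- If e p is nonzero modulo p only, this sequence is extremal for U(n).
    barrier : List ℕ → List A
    barrier []       = []
    barrier (p ∷ ps) = barrier ps ++ e p ∷ barrier ps

    -- The length is 2^r - 1 for r primes, one less than the value of the constant.
    length-barrier : ∀ ps → suc (length (barrier ps)) ≡ 2 ℕ.^ length ps
    length-barrier [] = refl
    length-barrier (p ∷ ps) = begin
      suc (length (barrier ps ++ e p ∷ barrier ps))            ≡⟨ cong suc (List.length-++ (barrier ps)) ⟩
      suc (length (barrier ps)) ℕ.+ suc (length (barrier ps))  ≡⟨ cong₂ ℕ._+_ (length-barrier ps) (length-barrier ps) ⟩
      2 ℕ.^ length ps ℕ.+ 2 ℕ.^ length ps                      ≡⟨ cong (2 ℕ.^ length ps ℕ.+_) (ℕ.+-identityʳ _) ⟨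
      2 ℕ.^ length (p ∷ ps)                                    ∎
      where open ≡-Reasoning

    All-barrier : ∀ {P : Pred A 0ℓ} {ps} → All (λ p → P (e p)) ps → All P (barrier ps)
    All-barrier []       = []
    All-barrier (z ∷ zs) = All.++⁺ (All-barrier zs) (z ∷ All-barrier zs)

    -- A block containing the middle term has it as its single exception for p. Any other block lies
    -- inside one of the two shorter copies, to which induction applies.
    barrier-infix : ∀ {ps} → Unique ps → (∀ {p} → p ∈ ps → ¬ Z p (e p)) →
      (∀ {p q} → p ∈ ps → q ∈ ps → p ≢ q → Z p (e q)) →
      ∀ {ys} → ys ≢ [] → Infix _≡_ ys (barrier ps) → Any (λ p → LoneExcept (Z p) ys) ps
    barrier-infix {[]} _ _ _ ys≢[] (here []) = contradiction refl ys≢[]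
    barrier-infix {p ∷ ps} (p∉ ∷ unique) ¬z z ys≢[] inf
      with LoneExcept-infix inf (LoneExcept-++ zs (¬z (here refl)) zs)
      where
      zs : All (Z p) (barrier ps)
      zs = All-barrier (All.tabulate λ q∈ → z (here refl) (there q∈) (All.lookup p∉ q∈))
    ... | inj₁ lone = here lone
    ... | inj₂ zys with infix-avoid (barrier ps) inf zys (¬z (here refl))
    ...   | inj₁ inf′ = there (barrier-infix unique (¬z ∘ there) (λ p∈ q∈ → z (there p∈) (there q∈)) ys≢[] inf′)
    ...   | inj₂ inf′ = there (barrier-infix unique (¬z ∘ there) (λ p∈ q∈ → z (there p∈) (there q∈)) ys≢[] inf′)

-- The ring ℤ/n

module _ {n : ℕ} .{{_ : NonZero n}} where

  residue-cong : ∀ {x y} → + n ∣ᶻ x - y → residue {n} x ≡ residue {n} y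
  residue-cong {x} {y} d = ∣-∸⇒≡ (∣-comb₂ {a = x - + toℕ (residue {n} x)} -1ℤ 1ℤ (∣x-residue x)
    (∣m∣n⇒∣m+n d (∣x-residue y)) (lemma x y _ _))
    where
    lemma : ∀ x y r s → r - s ≡ -1ℤ * (x - r) + 1ℤ * (x - y + (y - s))
    lemma = solve-∀

  toℤ : ℤ/ n → ℤ
  toℤ x = + toℕ x

  residue-toℤ : ∀ x → residue {n} (toℤ x) ≡ x
  residue-toℤ x = sym (∣-∸⇒≡ (∣x-residue (toℤ x)))

  *ₙ≡residue : ∀ x y → x *ₙ y ≡ residue {n} (toℤ x * toℤ y)
  *ₙ≡residue x y = cong (residue {n}) (ℤ.pos-* (toℕ x) (toℕ y))

  -- Passes from arithmetic on least residues to integer dot products: each ring operation changes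
  -- the integer value by a multiple of n.
  ∣-sumₙ : ∀ ys (a : Fin (length ys) → ℤ/ n) →
    + n ∣ᶻ dot (toℤ ∘ a) (toℤ ∘ lookup ys) - toℤ (sumₙ (zipWith _*ₙ_ (tabulate a) ys))
  ∣-sumₙ []       a = ∣x-residue 0ℤ
  ∣-sumₙ (y ∷ ys) a = ∣-comb₂ 1ℤ 1ℤ
    (∣m∣n⇒∣m+n product-step (∣-sumₙ ys (a ∘ suc))) (∣x-residue (toℤ (a zero *ₙ y) + toℤ s))
    (lemma (toℤ (a zero) * toℤ y) (dot (toℤ ∘ a ∘ suc) (toℤ ∘ lookup ys)) (toℤ (a zero *ₙ y)) (toℤ s)
      (toℤ (a zero *ₙ y +ₙ s)))
    where
    s = sumₙ (zipWith _*ₙ_ (tabulate (a ∘ suc)) ys)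
    lemma : ∀ ay d x s t → ay + d - t ≡ 1ℤ * (ay - x + (d - s)) + 1ℤ * (x + s - t)
    lemma = solve-∀
    product-step : + n ∣ᶻ toℤ (a zero) * toℤ y - toℤ (a zero *ₙ y)
    product-step = subst (λ r → + n ∣ᶻ toℤ (a zero) * toℤ y - toℤ r) (sym (*ₙ≡residue (a zero) y))
      (∣x-residue (toℤ (a zero) * toℤ y))

  module _ {A : Pred (ℤ/ n) 0ℓ} where

    weightedZeroSum⁺ : ∀ {ys} → ys ≢ [] → (a : Fin (length ys) → ℤ/ n) → (∀ i → A (a i)) →
      + n ∣ᶻ dot (toℤ ∘ a) (toℤ ∘ lookup ys) → WeightedZeroSum A ys
    weightedZeroSum⁺ {ys} ys≢[] a Aa n∣ = ys≢[] , tabulate a , List.length-tabulate a , All.tabulate⁺ Aa ,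
      trans (sym (residue-toℤ _)) (residue-cong {x = toℤ (sumₙ (zipWith _*ₙ_ (tabulate a) ys))} {0ℤ}
        (∣-comb₂ {b = dot (toℤ ∘ a) (toℤ ∘ lookup ys)} -1ℤ 1ℤ
        (∣-sumₙ ys a) n∣ (lemma (dot (toℤ ∘ a) (toℤ ∘ lookup ys)) _)))
      where
      lemma : ∀ d s → s - 0ℤ ≡ -1ℤ * (d - s) + 1ℤ * d
      lemma = solve-∀

    weightedZeroSum⁻ : ∀ {ys} → WeightedZeroSum A ys →
      ys ≢ [] × (∃[ a ] (∀ i → A (a i)) × + n ∣ᶻ dot (toℤ ∘ a) (toℤ ∘ lookup ys))
    weightedZeroSum⁻ {ys} (ys≢[] , as , len , Aas , sum≡0) = ys≢[] , from-tabulate (as-tabulate as len)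
      where
      as-tabulate : ∀ {k} (as : List (ℤ/ n)) → length as ≡ k → ∃[ a ] tabulate {n = k} a ≡ as
      as-tabulate as refl = lookup as , List.tabulate-lookup as
      from-tabulate : (∃[ a ] tabulate {n = length ys} a ≡ as) →
        ∃[ a ] (∀ i → A (a i)) × + n ∣ᶻ dot (toℤ ∘ a) (toℤ ∘ lookup ys)
      from-tabulate (a , refl) = a , All.tabulate⁻ Aas ,
        ∣-comb₂ 1ℤ -1ℤ (subst (λ r → + n ∣ᶻ dot (toℤ ∘ a) (toℤ ∘ lookup ys) - toℤ r) sum≡0 (∣-sumₙ ys a))
          (∣x-residue {n} 0ℤ)
          (lemma (dot (toℤ ∘ a) (toℤ ∘ lookup ys)) _)
        where
        lemma : ∀ d r → d ≡ 1ℤ * (d - r) + -1ℤ * (0ℤ - r)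
        lemma = solve-∀

  HasConsecutiveZeroSum-mono : ∀ {A B : Pred (ℤ/ n) 0ℓ} → (∀ {x} → A x → B x) →
    ∀ {xs} → HasConsecutiveZeroSum A xs → HasConsecutiveZeroSum B xs
  HasConsecutiveZeroSum-mono A⊆B (ys , inf , ys≢[] , as , len , Aas , sum≡0) =
    ys , inf , ys≢[] , as , len , All.map A⊆B Aas , sum≡0

-- Weighted zero-sums modulo a squarefree n with all prime divisors at least 7

module SquarefreeModulus (n : ℕ) .{{_ : NonZero n}} (sf : Squarefree n) (7≤ : ∀ p → Prime p → p ∣ n → 7 ≤ p) where

  ps : List ℕ
  ps = factors (factorise n)

  n≡ : n ≡ product ps
  n≡ = PrimeFactorisation.isFactorisation (factorise n)

  primes : All Prime ps
  primes = PrimeFactorisation.factorsPrime (factorise n)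

  unique : Unique ps
  unique = squarefree⇒Unique primes (subst Squarefree n≡ sf)

  large : All (λ p → Prime p × 7 ≤ p) ps
  large = All.tabulate λ p∈ → All.lookup primes p∈ ,
    7≤ _ (All.lookup primes p∈) (subst (_ ∣_) (sym n≡) (∈⇒∣product p∈))

  ∣n : ∀ {p} → p ∈ ps → + p ∣ᶻ + n
  ∣n {p} p∈ = subst (λ m → + p ∣ᶻ + m) (sym n≡) (∈⇒∣ᶻproduct p∈)

  n∣ : ∀ {x} → All (λ p → + p ∣ᶻ x) ps → + n ∣ᶻ x
  n∣ {x} all = subst (λ m → + m ∣ᶻ x) (sym n≡) (product-∣ primes unique all)

  Zero : ℕ → Pred (ℤ/ n) 0ℓ
  Zero p x = + p ∣ᶻ toℤ x

  zero? : ∀ p → Decidable (Zero p)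
  zero? p x = + p ∣? toℤ x

  values : (ys : List (ℤ/ n)) → Vector ℤ (length ys)
  values ys i = toℤ (lookup ys i)

  U⇒∤ : ∀ {a} → U n a → ∀ {p} → p ∈ ps → ¬ Zero p a
  U⇒∤ {a} (b , ba≡1 , _) {p} p∈ p∣a =
    ModPrime.LargePrime.¬Z-1 (proj₁ (All.lookup large p∈)) (proj₂ (All.lookup large p∈))
    (∣-comb₂ (toℤ b) -1ℤ p∣a (∣-trans (∣n p∈) (residue-≡⇒∣ {n} {toℤ b * toℤ a} {1ℤ}
      (trans (sym (*ₙ≡residue b a)) ba≡1))) (lemma (toℤ b) (toℤ a)))
    where
    lemma : ∀ b a → 1ℤ ≡ b * a + -1ℤ * (b * a - 1ℤ)
    lemma = solve-∀

  -- Inverses modulo the single primes are glued by the Chinese remainder theorem into an inverse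
  -- modulo n.
  ∤⇒U : ∀ {a} → All (λ p → ¬ Zero p a) ps → U n a
  ∤⇒U {a} ∤a = from-inverses (choose {P = λ p x → + p ∣ᶻ toℤ a * x - 1ℤ} 0ℤ
      (All.zipWith (λ (pr , ∤) → ModPrime.Z-inverse pr ∤) (primes , ∤a)))
    where
    lemma : ∀ a x f → a * x - 1ℤ ≡ a * (x - f) + 1ℤ * (a * f - 1ℤ)
    lemma = solve-∀
    lemma′ : ∀ a x r → a * r - 1ℤ ≡ 1ℤ * (a * x - 1ℤ) + - a * (x - r)
    lemma′ = solve-∀
    from-inverse : ∀ x → + n ∣ᶻ toℤ a * x - 1ℤ → U n a
    from-inverse x inv = b ,
      trans (*ₙ≡residue b a) (trans (cong residue (ℤ.*-comm (toℤ b) (toℤ a)))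
        (residue-cong {n} {toℤ a * toℤ b} {1ℤ} ab≡1)) ,
      trans (*ₙ≡residue a b) (residue-cong {n} {toℤ a * toℤ b} {1ℤ} ab≡1)
      where
      b = residue {n} x
      ab≡1 : + n ∣ᶻ toℤ a * toℤ b - 1ℤ
      ab≡1 = ∣-comb₂ 1ℤ (- toℤ a) inv (∣x-residue {n} x) (lemma′ (toℤ a) x (toℤ b))
    from-inverses : (∃[ f ] All (λ p → + p ∣ᶻ toℤ a * f p - 1ℤ) ps) → U n a
    from-inverses (f , invs) = glue (chinese-remainder primes unique f)
      where
      glue : (∃[ x ] All (λ p → + p ∣ᶻ x - f p) ps) → U n a
      glue (x , x≡f) = from-inverse x (n∣ (All.zipWith (λ {p} (e , i) → ∣-comb₂ (toℤ a) 1ℤ e i (lemma (toℤ a) x (f p)))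
        (x≡f , invs)))

  -- For each index the coefficients modulo the primes are glued into one residue modulo n. It has
  -- the same Legendre symbols, so it is a unit and its Jacobi symbol is the balanced value 1.
  Balanced⇒S : ∀ {ys} → ys ≢ [] → Family.Balanced (values ys) unique → WeightedZeroSum (S n) ys
  Balanced⇒S {ys} ys≢[] (c , sol , sym≡1) =
    weightedZeroSum⁺ {A = S n} {ys} ys≢[] a (λ i → unit i , jacobi≡1 i) (n∣ zero-sum)
    where
    glued : ∀ i → ∃[ x ] All (λ p → + p ∣ᶻ x - c p i) ps
    glued i = chinese-remainder primes unique (λ p → c p i)
    a : Fin (length ys) → ℤ/ n
    a i = residue (proj₁ (glued i))
    lemma : ∀ x r c → r - c ≡ -1ℤ * (x - r) + 1ℤ * (x - c)
    lemma = solve-∀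
    a≡c : ∀ i {p} → p ∈ ps → + p ∣ᶻ toℤ (a i) - c p i
    a≡c i {p} p∈ = ∣-comb₂ -1ℤ 1ℤ (∣-trans (∣n p∈) (∣x-residue {n} (proj₁ (glued i)))) (All.lookup (proj₂ (glued i)) p∈)
      (lemma (proj₁ (glued i)) (toℤ (a i)) (c p i))
    legendre-a : ∀ i {p} → p ∈ ps → legendre (toℤ (a i)) p ≡ legendre (c p i) p
    legendre-a i {p} p∈ = ModPrime.LargePrime.legendre-cong (proj₁ (All.lookup large p∈)) (proj₂ (All.lookup large p∈))
      {toℤ (a i)} {c p i} (a≡c i p∈)
    unit : ∀ i → U n (a i)
    unit i = ∤⇒U (All.tabulate λ {p} p∈ → Support.IsSign-legendre⇒¬Z (proj₁ (All.lookup large p∈)) (values ys)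
      (proj₂ (All.lookup large p∈)) (subst IsSign (sym (legendre-a i p∈)) (proj₁ (All.lookup sol p∈) i)))
    jacobi≡1 : ∀ i → jacobi (toℤ (a i)) n ≡ 1ℤ
    jacobi≡1 i = trans
      (prod-cong {legendre (toℤ (a i))} {λ p → legendre (c p i) p} {ps} (All.tabulate (legendre-a i))) (sym≡1 i)
    zero-sum : All (λ p → + p ∣ᶻ dot (toℤ ∘ a) (values ys)) ps
    zero-sum = All.tabulate λ {p} p∈ →
      ∣-dot-cong (toℤ ∘ a) (c p) (values ys) (λ i → a≡c i p∈) (proj₂ (All.lookup sol p∈))

  ¬lone : ∀ {p ys} → ¬ LoneExcept (Zero p) ys → ¬ Lone p (values ys)
  ¬lone {ys = ys} ¬l (i , ∤i , rest) = ¬l (lookup⇒LoneExcept ys i ∤i rest)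

  ¬loneAll : ∀ {ys} → All (λ p → ¬ LoneExcept (Zero p) ys) ps → All (λ p → ¬ Lone p (values ys)) ps
  ¬loneAll {ys} = All.map λ {p} → ¬lone {p} {ys}

  some-zero⇒S : ∀ {ys} → ys ≢ [] → All (λ p → ¬ LoneExcept (Zero p) ys) ps →
    Any (λ p → All (Zero p) ys) ps → WeightedZeroSum (S n) ys
  some-zero⇒S {ys} ys≢[] ¬l any = Balanced⇒S ys≢[]
    (Family.None⇒Balanced (values ys) unique large (¬loneAll ¬l) (Any.map All⇒lookup any))

  nonzero⇒S : ∀ {ys} → 3 ≤ length ys → All (λ p → ¬ LoneExcept (Zero p) ys) ps →
    (∀ i → Any (λ p → ¬ Zero p (lookup ys i)) ps) → WeightedZeroSum (S n) ys
  nonzero⇒S {ys} 3≤ ¬l nonzero = Balanced⇒S (length>0⇒≢[] (ℕ.≤-trans (s≤s z≤n) 3≤))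
    (Family.nonzero⇒Balanced (values ys) unique large (¬loneAll ¬l) 3≤ nonzero)

  -- The necessary half of the criterion for U(n): units modulo n stay units modulo p, where a lone
  -- nonzero term cannot be cancelled.
  U⇒¬lone : ∀ {ys} → WeightedZeroSum (U n) ys → ∀ {p} → p ∈ ps → ¬ LoneExcept (Zero p) ys
  U⇒¬lone {ys} zs {p} p∈ lone = contra (weightedZeroSum⁻ {A = U n} {ys} zs)
    where
    contra : ¬ (ys ≢ [] × (∃[ a ] (∀ i → U n (a i)) × + n ∣ᶻ dot (toℤ ∘ a) (values ys)))
    contra (_ , a , Ua , n∣dot) = Support.Lone⇒¬Z-dot (All.lookup primes p∈) (values ys) (LoneExcept⇒lookup lone)
      (toℤ ∘ a) (λ i → U⇒∤ (Ua i) p∈) (∣-trans (∣n p∈) n∣dot)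

  module _ (∣ps∣≥1 : 1 ≤ length ps) where

    -- The term is 0 modulo n and forms a block of length 1 by itself; some prime of the list
    -- witnesses its vanishing.
    zero-term⇒S : ∀ {xs} i → All (λ p → Zero p (lookup xs i)) ps → HasConsecutiveZeroSum (S n) xs
    zero-term⇒S {xs} i zs = lookup xs i ∷ [] , infix-lookup xs i ,
      some-zero⇒S (λ ()) (All.map (λ z → λ { (here ¬z _) → ¬z z ; (there _ ()) }) zs) (first ∣ps∣≥1 zs)
      where
      first : ∀ {qs} → 1 ≤ length qs → All (λ p → Zero p (lookup xs i)) qs →
        Any (λ p → All (Zero p) (lookup xs i ∷ [])) qs
      first _ (z ∷ _) = here (z ∷ [])

    zero-or-nonzero : ∀ xs → HasConsecutiveZeroSum (S n) xs ⊎ (∀ i → Any (λ p → ¬ Zero p (lookup xs i)) ps)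
    zero-or-nonzero xs with Fin.any? (λ i → All.all? (λ p → zero? p (lookup xs i)) ps)
    ... | yes (i , zs) = inj₁ (zero-term⇒S i zs)
    ... | no none = inj₂ λ i → All.¬All⇒Any¬ (λ p → zero? p (lookup xs i)) ps λ zs → none (i , zs)

    -- Unless some term is 0, `halving` yields either a block vanishing at some prime or the whole
    -- sequence. In the latter case there are at least three terms, all nonzero, and no prime has a
    -- lone one.
    Forces-S : 3 ≤ 2 ℕ.^ length ps → Forces (S n) (2 ℕ.^ length ps)
    Forces-S 3≤ xs len = by-cases (halving zero? (length ps) ps refl xs (ℕ.≤-reflexive (sym len))) (zero-or-nonzero xs)
      where
      by-cases : (∃[ ys ] Infix _≡_ ys xs × ys ≢ [] × All (λ p → ¬ LoneExcept (Zero p) ys) ps ×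
          (ys ≡ xs ⊎ Any (λ p → All (Zero p) ys) ps)) →
        HasConsecutiveZeroSum (S n) xs ⊎ (∀ i → Any (λ p → ¬ Zero p (lookup xs i)) ps) → HasConsecutiveZeroSum (S n) xs
      by-cases _ (inj₁ has) = has
      by-cases (ys , inf , ys≢[] , ¬l , inj₂ any) (inj₂ _) = ys , inf , some-zero⇒S ys≢[] ¬l any
      by-cases (_ , inf , _ , ¬l , inj₁ refl) (inj₂ nonzero) =
        xs , inf , nonzero⇒S (subst (3 ≤_) (sym len) 3≤) ¬l nonzero

    -- Let a U(n)-weighted zero-sum block vanish entirely at no prime. A lone nonzero term of the
    -- whole sequence at p would leave the block with one or no nonzero term at p, and both are
    -- excluded. So the whole sequence would be S(n)-weighted zero-sum.
    S-free⇒U-free : ∀ {xs} → 3 ≤ length xs → ¬ HasConsecutiveZeroSum (S n) xs → ¬ HasConsecutiveZeroSum (U n) xs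
    S-free⇒U-free {xs} 3≤ S-free (ys , inf , zs) with Any.any? (λ p → All.all? (zero? p) ys) ps
    ... | yes any = S-free (ys , inf , some-zero⇒S (proj₁ zs) (All.tabulate (U⇒¬lone zs)) any)
    ... | no none = [ S-free , (λ nonzero → S-free (xs , infix-refl , nonzero⇒S 3≤ (All.tabulate ¬lone-xs) nonzero)) ]′
          (zero-or-nonzero xs)
      where
      ¬lone-xs : ∀ {p} → p ∈ ps → ¬ LoneExcept (Zero p) xs
      ¬lone-xs p∈ lone = [ U⇒¬lone zs p∈ , (λ all → none (lose p∈ all)) ]′ (LoneExcept-infix inf lone)

  -- This is the Chinese remainder idempotent of p, congruent to 1 modulo p and to 0 modulo the
  -- other primes.
  separator : ∀ p → ∃[ e ] (p ∈ ps → ¬ Zero p e) × (∀ {q} → q ∈ ps → q ≢ p → Zero q e)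
  separator p = from-crt (chinese-remainder primes unique δ)
    where
    δ : ℕ → ℤ
    δ q with q ℕ.≟ p
    ... | yes _ = 1ℤ
    ... | no _  = 0ℤ
    δ-same : δ p ≡ 1ℤ
    δ-same with p ℕ.≟ p
    ... | yes _  = refl
    ... | no p≢p = contradiction refl p≢p
    δ-other : ∀ {q} → q ≢ p → δ q ≡ 0ℤ
    δ-other {q} q≢p with q ℕ.≟ p
    ... | yes q≡p = contradiction q≡p q≢p
    ... | no _    = refl
    lemma : ∀ x r d → d ≡ 1ℤ * (r + (x - r)) + -1ℤ * (x - d)
    lemma = solve-∀
    lemma′ : ∀ x r d → r ≡ 1ℤ * (x - d + d) + -1ℤ * (x - r)
    lemma′ = solve-∀
    from-crt : (∃[ x ] All (λ q → + q ∣ᶻ x - δ q) ps) →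
      ∃[ e ] (p ∈ ps → ¬ Zero p e) × (∀ {q} → q ∈ ps → q ≢ p → Zero q e)
    from-crt (x , x≡δ) = residue x , nonzero , vanish
      where
      nonzero : p ∈ ps → ¬ Zero p (residue x)
      nonzero p∈ z = ModPrime.LargePrime.¬Z-1 (proj₁ (All.lookup large p∈)) (proj₂ (All.lookup large p∈))
        (subst (+ p ∣ᶻ_) δ-same (∣-comb₂ 1ℤ -1ℤ (∣m∣n⇒∣m+n z (∣-trans (∣n p∈) (∣x-residue {n} x))) (All.lookup x≡δ p∈)
          (lemma x (toℤ (residue {n} x)) (δ p))))
      vanish : ∀ {q} → q ∈ ps → q ≢ p → Zero q (residue x)
      vanish {q} q∈ q≢p = ∣-comb₂ 1ℤ -1ℤ
        (∣m∣n⇒∣m+n (All.lookup x≡δ q∈) (subst (+ q ∣ᶻ_) (sym (δ-other q≢p)) (divides 0ℤ refl)))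
        (∣-trans (∣n q∈) (∣x-residue {n} x)) (lemma′ x (toℤ (residue {n} x)) (δ q))

  -- For j < 2^r the barrier has at least j terms. Its first j terms contain no zero-sum block,
  -- since every nonempty block has a lone nonzero term at some prime.
  Forces-U⇒≥ : ∀ j → Forces (U n) j → 2 ℕ.^ length ps ≤ j
  Forces-U⇒≥ j forces = ℕ.≮⇒≥ λ j< → contra j< (forces (take j w) (len j<))
    where
    e : ℕ → ℤ/ n
    e p = proj₁ (separator p)
    w : List (ℤ/ n)
    w = barrier zero? e ps
    len : j ℕ.< 2 ℕ.^ length ps → length (take j w) ≡ j
    len j< = trans (List.length-take j w)
      (ℕ.m≤n⇒m⊓n≡m (ℕ.s≤s⁻¹ (subst (j ℕ.<_) (sym (length-barrier zero? e ps)) j<)))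
    contra : j ℕ.< 2 ℕ.^ length ps → ¬ HasConsecutiveZeroSum (U n) (take j w)
    contra j< (ys , inf , zs) = absurd (find (barrier-infix zero? e unique
        (λ {p} p∈ → proj₁ (proj₂ (separator p)) p∈) (λ {p} {q} p∈ q∈ p≢q → proj₂ (proj₂ (separator q)) p∈ p≢q)
        (proj₁ zs) (subst (Infix _≡_ ys) (List.take++drop≡id j w) (inf ⁱ++ drop j w))))
      where
      absurd : ¬ (∃[ p ] p ∈ ps × LoneExcept (Zero p) ys)
      absurd (p , p∈ , lone) = U⇒¬lone zs p∈ lone

-- The common value of the two constants and the comparison of extremal sequences

CExtremal-cong : ∀ {n} .{{_ : NonZero n}} {A B : Pred (ℤ/ n) 0ℓ} → (∀ {x} → A x → B x) → (∀ {x} → B x → A x) →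
  ∀ {xs} → CExtremal A xs → CExtremal B xs
CExtremal-cong A⊆B B⊆A (k , (1≤k , forces , least) , len , free) =
  k , (1≤k , (λ xs l → HasConsecutiveZeroSum-mono A⊆B (forces xs l)) ,
    λ j 1≤j forces′ → least j 1≤j λ xs l → HasConsecutiveZeroSum-mono B⊆A (forces′ xs l)) ,
  len , free ∘ HasConsecutiveZeroSum-mono B⊆A

theorem4p1 : (n : ℕ) → .{{_ : NonZero n}} → Squarefree n → ¬ Prime n →
    (∀ p → Prime p → p ∣ n → 7 ≤ p) →
    (xs : List (ℤ/ n)) → CExtremal (S n) xs ⇔ CExtremal (U n) xs
theorem4p1 n sf ¬prime 7≤ xs = by-factors ps refl
  where
  open SquarefreeModulus n sf 7≤
  by-factors : ∀ qs → ps ≡ qs → CExtremal (S n) xs ⇔ CExtremal (U n) xs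
  -- Here n = 1 and every Jacobi symbol is an empty product, so S(n) and U(n) coincide.
  by-factors [] ps≡ = mk⇔ (CExtremal-cong proj₁ U⊆S) (CExtremal-cong U⊆S proj₁)
    where
    U⊆S : ∀ {x} → U n x → S n x
    U⊆S {x} u = u , cong (prod (legendre (toℤ x))) ps≡
  -- A single prime factor would make n itself prime.
  by-factors (p ∷ []) ps≡ = contradiction
    (subst Prime (sym (trans n≡ (trans (cong product ps≡) (ℕ.*-identityʳ p))))
      (All.head (subst (All Prime) ps≡ primes))) ¬prime
  by-factors (p ∷ q ∷ qs) ps≡ = mk⇔ to from
    where
    K = 2 ℕ.^ length ps
    2≤∣ps∣ : 2 ≤ length ps
    2≤∣ps∣ = subst (λ ps → 2 ≤ length ps) (sym ps≡) (s≤s (s≤s z≤n))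
    1≤∣ps∣ : 1 ≤ length ps
    1≤∣ps∣ = ℕ.<⇒≤ 2≤∣ps∣
    4≤K : 4 ≤ K
    4≤K = ℕ.^-monoʳ-≤ 2 2≤∣ps∣
    S⊆U : ∀ {k} → Forces (S n) k → Forces (U n) k
    S⊆U forces xs len = HasConsecutiveZeroSum-mono proj₁ (forces xs len)
    forces-K : Forces (S n) K
    forces-K = Forces-S 1≤∣ps∣ (ℕ.<⇒≤ 4≤K)
    IsC-U : IsC (U n) K
    IsC-U = 2^>0 (length ps) , S⊆U forces-K , λ j _ → Forces-U⇒≥ j
    IsC-S : IsC (S n) K
    -- The lower bound passes from U(n) to the smaller set S(n), whose zero-sums are harder to
    -- force.
    IsC-S = 2^>0 (length ps) , forces-K , λ j _ → Forces-U⇒≥ j ∘ S⊆U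
    IsC-unique : ∀ {A : Pred (ℤ/ n) 0ℓ} {k l} → IsC A k → IsC A l → k ≡ l
    IsC-unique (1≤k , fk , mink) (1≤l , fl , minl) = ℕ.≤-antisym (mink _ 1≤l fl) (minl _ 1≤k fk)
    to : CExtremal (S n) xs → CExtremal (U n) xs
    -- An extremal sequence has K - 1 terms, at least 3 because K is at least 4; this is the length
    -- that `S-free⇒U-free` requires.
    to (k , isC , len , free) = K , IsC-U , len′ ,
      S-free⇒U-free 1≤∣ps∣ (subst (3 ≤_) (sym len′) (ℕ.∸-monoˡ-≤ 1 4≤K)) free
      where
      len′ : length xs ≡ K ℕ.∸ 1
      len′ = trans len (cong (ℕ._∸ 1) (IsC-unique isC IsC-S))
    from : CExtremal (U n) xs → CExtremal (S n) xs
    -- Once the constants agree, this direction follows from the inclusion of S(n) in U(n).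
    from (k , isC , len , free) = K , IsC-S , trans len (cong (ℕ._∸ 1) (IsC-unique isC IsC-U)) ,
      free ∘ HasConsecutiveZeroSum-mono proj₁
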